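{- Let $(S,d)$ be a $k$-center instance with $|S|=n$, optimal radius $r^*$ and optimal clusters $C_1,\dots,C_k$, let $\epsilon>0$, and suppose every optimal cluster has size greater than $2\epsilon n$ and at least three optimal clusters are $(3,\epsilon)$-locally perturbation resilient. Then for every pair of distinct $(3,\epsilon)$-locally perturbation resilient clusters $C_i,C_j$ and all $u\in C_i$, $v\in C_j$, we have $d(u,v)>r^*$.
   Context: A $k$-center instance is a finite set $S$ with a metric $d$; for $X\subseteq S$, $|X|=k$, the cost is $\max_{v\in S}\min_{x\in X}d(v,x)$, $r^*$ is the minimum cost, and the clustering induced by $X$ is the Voronoi partition (each point assigned to its closest center). An $\alpha$-perturbation of $d$ is any $d':S\times S\to\mathbb{R}_{\ge0}$ with $d(u,v)\le d'(u,v)\le\alpha d(u,v)$ for all $u,v$ (not necessarily a metric). Two sets $A,B$ are $\epsilon$-close if $|A\setminus B|+|B\setminus A|\le\epsilon n$. An optimal cluster $C_i$ is $(\alpha,\epsilon)$-locally perturbation resilient if for every $\alpha$-perturbation $d'$, the optimal $k$-center clustering under $d'$ contains a cluster that is $\epsilon$-close to $C_i$. -}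

module Defs where

open import Level using (0ℓ)
open import Data.Nat as ℕ using (ℕ; zero; suc)
open import Data.Fin using (Fin; _≟_)
open import Data.Fin.Subset using (Subset; _∈_; _─_; ∣_∣)
open import Data.Vec using (tabulate)
open import Data.Product using (Σ; ∃; _×_; _,_)
open import Relation.Nullary using (¬_)
open import Relation.Nullary.Decidable using (⌊_⌋)
open import Relation.Binary.PropositionalEquality using (_≡_; _≢_)
open import Relation.Binary.Structures using (IsTotalOrder)
open import Algebra.Structures using (IsCommutativeRing)

record OrderedField : Set₁ where
  infixl 6 _+_
  infixl 7 _*_
  infix 4 _≤_
  field
    Carrier : Set
    _+_ _*_ : Carrier → Carrier → Carrier
    -_      : Carrier → Carrier
    0# 1#   : Carrier
    _≤_     : Carrier → Carrier → Set
    isCommutativeRing : IsCommutativeRing _≡_ _+_ _*_ -_ 0# 1#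
    isTotalOrder      : IsTotalOrder _≡_ _≤_
    0≢1      : 0# ≢ 1#
    inverse  : ∀ x → x ≢ 0# → Σ Carrier (λ y → x * y ≡ 1#)
    +-monoˡ-≤ : ∀ {x y} z → x ≤ y → x + z ≤ y + z
    *-nonneg  : ∀ {x y} → 0# ≤ x → 0# ≤ y → 0# ≤ x * y

  infix 4 _<_
  _<_ : Carrier → Carrier → Set
  x < y = x ≤ y × x ≢ y

  fromℕ : ℕ → Carrier
  fromℕ zero    = 0#
  fromℕ (suc m) = 1# + fromℕ m

module KCenter (F : OrderedField) where
  open OrderedField F

  Dist : ℕ → Set
  Dist n = Fin n → Fin n → Carrier

  record IsMetric {n : ℕ} (d : Dist n) : Set where
    field
      nonneg   : ∀ u v → 0# ≤ d u v
      zero-iff : ∀ u v → d u v ≡ 0# → u ≡ v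
      refl0    : ∀ u → d u u ≡ 0#
      sym      : ∀ u v → d u v ≡ d v u
      triangle : ∀ u v w → d u w ≤ d u v + d v w

  IsPerturbation : {n : ℕ} → Carrier → Dist n → Dist n → Set
  IsPerturbation α d d' = ∀ u v → (d u v ≤ d' u v) × (d' u v ≤ α * d u v)

  -- Cost of the center set X is (exactly) r:
  -- r = max_{v} min_{x ∈ X} d(v,x)
  IsCost : {n : ℕ} → Dist n → Subset n → Carrier → Set
  IsCost {n} d X r =
    (∀ v → Σ (Fin n) λ x → x ∈ X × d v x ≤ r) ×
    Σ (Fin n) (λ v → ∀ x → x ∈ X → r ≤ d v x)

  IsOptimalCenters : {n : ℕ} → ℕ → Dist n → Subset n → Carrier → Set
  IsOptimalCenters {n} k d X r =
    ∣ X ∣ ≡ k × IsCost d X r ×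
    (∀ (Y : Subset n) (s : Carrier) → ∣ Y ∣ ≡ k → IsCost d Y s → r ≤ s)

  IsVoronoi : {n : ℕ} → Dist n → Subset n → (Fin n → Fin n) → Set
  IsVoronoi {n} d X a = ∀ v → a v ∈ X × (∀ x → x ∈ X → d v (a v) ≤ d v x)

  record OptClustering {n : ℕ} (k : ℕ) (d : Dist n) : Set where
    field
      centers : Subset n
      radius  : Carrier
      assign  : Fin n → Fin n
      optimal : IsOptimalCenters k d centers radius
      voronoi : IsVoronoi d centers assign

  cluster : {n : ℕ} → (Fin n → Fin n) → Fin n → Subset n
  cluster a c = tabulate (λ v → ⌊ a v ≟ c ⌋)

  Close : {n : ℕ} → Carrier → Subset n → Subset n → Set
  Close {n} ε A B = fromℕ (∣ A ─ B ∣ ℕ.+ ∣ B ─ A ∣) ≤ ε * fromℕ n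

  LocallyPR : {n : ℕ} → ℕ → Dist n → Carrier → Carrier → Subset n → Set
  LocallyPR {n} k d α ε C =
    ∀ (d' : Dist n) → IsPerturbation α d d' →
    (P : OptClustering k d') →
    Σ (Fin n) λ c → c ∈ OptClustering.centers P ×
      Close ε (cluster (OptClustering.assign P) c) C

{-# OPTIONS --safe #-}
module Submission where

-- A set Y of k points that covers everything within 3r* is an optimal set of centers for a suitable
-- 3-perturbation with optimum 3r*, where each point with a member of Y nearer than r* must go to the
-- nearest one while the others may be sent to any member within 3r*.  So every resilient cluster is
-- captured, up to m = ⌊εn⌋ exceptions, by one member of Y, and distinct resilient clusters by distinct
-- members.  If d(u,v) ≤ r*, then u covers both clusters, and Y = X − {i,j} + {u,p} is admissible for
-- every p.  If no resilient cluster is covered by the other centers, p must then capture the cluster of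
-- i or that of j, and letting p run through a third resilient cluster, which can be replaced in its
-- turn, shows that i or j was covered after all.  If the cluster of some resilient j is covered by the
-- other centers, any p may replace j.  If p always captures the cluster of j, then any k-set containing
-- such a p is admissible, and for each pair p, q the clusters of the two other resilient centers i and
-- z have the same preference, opposite to that of j; among three such points they cannot have distinct
-- captors.  If instead p lets another center capture the cluster of j, then removing j and one of i, z
-- for p and the point nearest to j in its cluster makes that point capture both clusters.

open import Defs
open import Data.Nat as ℕ using (ℕ; zero; suc; z≤n; s≤s)
import Data.Nat.Properties as ℕₚ
open import Data.Fin using (Fin; toℕ; _≟_)
open import Data.Fin.Properties using (toℕ-injective; any?)
open import Data.Fin.Subset using (Subset; inside; outside; _∈_; _∉_; _⊆_; _∪_; _─_; ⁅_⁆; ∣_∣)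
import Data.Fin.Subset as Subset
open import Data.Fin.Subset.Properties
  using (_∈?_; ∣⊥∣≡0; ∣⁅x⁆∣≡1; x∈⁅x⁆; x∈p∪q⁺; p⊆q⇒∣p∣≤∣q∣; x∈p∧x∉q⇒x∈p─q)
open import Data.Vec using ([]; _∷_; here; there; _[_]≔_)
open import Data.Vec.Properties using ([]≔-updates; lookup∘update; lookup∘update′; lookup∘tabulate; []=⇒lookup; lookup⇒[]=)
open import Data.List using (List; []; _∷_; allFin; foldr; map; length)
open import Data.List.Properties using (length-map)
open import Data.List.Relation.Unary.All as All using (All; []; _∷_)
open import Data.List.Relation.Unary.All.Properties using () renaming (map⁺ to All-map⁺)
open import Data.List.Relation.Unary.AllPairs using ([]; _∷_)
open import Data.List.Relation.Unary.Unique.Propositional using (Unique)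
import Data.List.Membership.Propositional as List
open import Data.List.Membership.Propositional.Properties using (∈-allFin; ∈-map⁺)
open import Data.List.Relation.Unary.Any using (here; there)
open import Data.Product using (Σ; _×_; _,_; proj₁; proj₂)
open import Data.Sum using (_⊎_; inj₁; inj₂; [_,_]′)
open import Data.Empty using (⊥; ⊥-elim)
open import Relation.Nullary using (¬_; Dec; yes; no; contradiction)
open import Relation.Nullary.Decidable using (⌊_⌋; _×-dec_; ¬?; decidable-stable)
open import Relation.Binary.PropositionalEquality using (_≡_; _≢_; refl; sym; trans; cong; subst; subst₂; module ≡-Reasoning)
open import Relation.Binary.Structures using (IsTotalOrder)
open import Algebra.Structures using (IsCommutativeRing)
open import Function using (_∘_)

-- Order, multiples and integer parts in an ordered field.

module OrderedFieldProperties (F : OrderedField) where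
  open OrderedField F
  open IsCommutativeRing isCommutativeRing
    using (+-comm; +-assoc; +-identityˡ; +-identityʳ; *-identityˡ; *-identityʳ; distribˡ; distribʳ; -‿inverseʳ; -‿inverseˡ; zeroʳ)
  open IsTotalOrder isTotalOrder public
    using () renaming (refl to ≤-refl; trans to ≤-trans; antisym to ≤-antisym; total to ≤-total; reflexive to ≤-reflexive)

  -- Equality is decidable because totality must answer x ≤ x in one fixed way.
  _≟ᶠ_ : (x y : Carrier) → Dec (x ≡ y)
  x ≟ᶠ y with ≤-total x y in xy | ≤-total y x in yx
  ... | inj₁ p | inj₁ q = yes (≤-antisym p q)
  ... | inj₂ p | inj₂ q = yes (≤-antisym q p)
  ... | inj₁ _ | inj₂ _ = no λ { refl → contradiction (trans (sym xy) yx) λ () }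
  ... | inj₂ _ | inj₁ _ = no λ { refl → contradiction (trans (sym yx) xy) λ () }

  <⊎≥ : ∀ x y → x < y ⊎ y ≤ x
  <⊎≥ x y with ≤-total x y
  ... | inj₂ y≤x = inj₂ y≤x
  ... | inj₁ x≤y with x ≟ᶠ y
  ...   | yes x≡y = inj₂ (≤-reflexive (sym x≡y))
  ...   | no x≢y = inj₁ (x≤y , x≢y)

  _≤?_ : (x y : Carrier) → Dec (x ≤ y)
  x ≤? y with <⊎≥ y x
  ... | inj₁ (y≤x , y≢x) = no λ x≤y → y≢x (≤-antisym y≤x x≤y)
  ... | inj₂ x≤y = yes x≤y

  <⇒≱ : ∀ {x y} → x < y → ¬ (y ≤ x)
  <⇒≱ (x≤y , x≢y) y≤x = x≢y (≤-antisym x≤y y≤x)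

  ≤-<-trans : ∀ {x y z} → x ≤ y → y < z → x < z
  ≤-<-trans {x} {y} {z} x≤y y<z with <⊎≥ x z
  ... | inj₁ x<z = x<z
  ... | inj₂ z≤x = ⊥-elim (<⇒≱ y<z (≤-trans z≤x x≤y))

  <-≤-trans : ∀ {x y z} → x < y → y ≤ z → x < z
  <-≤-trans {x} {y} {z} x<y y≤z with <⊎≥ x z
  ... | inj₁ x<z = x<z
  ... | inj₂ z≤x = ⊥-elim (<⇒≱ x<y (≤-trans y≤z z≤x))

  +-mono-≤ : ∀ {x y z w} → x ≤ y → z ≤ w → x + z ≤ y + w
  +-mono-≤ {x} {y} {z} {w} x≤y z≤w =
    ≤-trans (+-monoˡ-≤ z x≤y) (subst₂ _≤_ (+-comm z y) (+-comm w y) (+-monoˡ-≤ y z≤w))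

  x≤x+y : ∀ {x y} → 0# ≤ y → x ≤ x + y
  x≤x+y {x} {y} 0≤y = subst (_≤ x + y) (+-identityʳ x) (+-mono-≤ ≤-refl 0≤y)

  double triple : Carrier → Carrier
  double x = x + x
  triple x = x + x + x

  double-* : ∀ x → (1# + 1#) * x ≡ double x
  double-* x = begin
    (1# + 1#) * x   ≡⟨ distribʳ x 1# 1# ⟩
    1# * x + 1# * x ≡⟨ cong (λ y → y + y) (*-identityˡ x) ⟩
    x + x           ∎
    where open ≡-Reasoning

  triple-* : ∀ x → (1# + 1# + 1#) * x ≡ triple x
  triple-* x = begin
    (1# + 1# + 1#) * x       ≡⟨ distribʳ x (1# + 1#) 1# ⟩
    (1# + 1#) * x + 1# * x   ≡⟨ cong (_+ 1# * x) (double-* x) ⟩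
    x + x + 1# * x           ≡⟨ cong (x + x +_) (*-identityˡ x) ⟩
    x + x + x                ∎
    where open ≡-Reasoning

  triple-mono : ∀ {x y} → x ≤ y → triple x ≤ triple y
  triple-mono x≤y = +-mono-≤ (+-mono-≤ x≤y x≤y) x≤y

  double≤triple : ∀ {x} → 0# ≤ x → double x ≤ triple x
  double≤triple = x≤x+y

  x≤triple : ∀ {x} → 0# ≤ x → x ≤ triple x
  x≤triple 0≤x = ≤-trans (x≤x+y 0≤x) (double≤triple 0≤x)

  0≤1 : 0# ≤ 1#
  0≤1 with ≤-total 0# 1#
  ... | inj₁ p = p
  ... | inj₂ 1≤0 = subst (0# ≤_) -1*-1≡1 (*-nonneg 0≤-1 0≤-1)
    where
    open ≡-Reasoning
    0≤-1 : 0# ≤ - 1#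
    0≤-1 = subst₂ _≤_ (-‿inverseʳ 1#) (+-identityˡ (- 1#)) (+-monoˡ-≤ (- 1#) 1≤0)
    -1*-1≡1 : - 1# * - 1# ≡ 1#
    -1*-1≡1 = begin
      - 1# * - 1#                    ≡⟨ sym (+-identityʳ _) ⟩
      - 1# * - 1# + 0#               ≡⟨ cong (- 1# * - 1# +_) (sym (-‿inverseˡ 1#)) ⟩
      - 1# * - 1# + (- 1# + 1#)      ≡⟨ sym (+-assoc _ _ _) ⟩
      - 1# * - 1# + - 1# + 1#        ≡⟨ cong (λ y → - 1# * - 1# + y + 1#) (sym (*-identityʳ (- 1#))) ⟩
      - 1# * - 1# + - 1# * 1# + 1#   ≡⟨ cong (_+ 1#) (sym (distribˡ (- 1#) (- 1#) 1#)) ⟩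
      - 1# * (- 1# + 1#) + 1#        ≡⟨ cong (λ y → - 1# * y + 1#) (-‿inverseˡ 1#) ⟩
      - 1# * 0# + 1#                 ≡⟨ cong (_+ 1#) (zeroʳ (- 1#)) ⟩
      0# + 1#                        ≡⟨ +-identityˡ 1# ⟩
      1#                             ∎

  fromℕ-nonneg : ∀ c → 0# ≤ fromℕ c
  fromℕ-nonneg zero = ≤-refl
  fromℕ-nonneg (suc c) = ≤-trans 0≤1 (x≤x+y (fromℕ-nonneg c))

  fromℕ-mono : ∀ {b c} → b ℕ.≤ c → fromℕ b ≤ fromℕ c
  fromℕ-mono {c = c} z≤n = fromℕ-nonneg c
  fromℕ-mono (s≤s b≤c) = +-mono-≤ ≤-refl (fromℕ-mono b≤c)

  fromℕ-+ : ∀ b c → fromℕ (b ℕ.+ c) ≡ fromℕ b + fromℕ c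
  fromℕ-+ zero c = sym (+-identityˡ _)
  fromℕ-+ (suc b) c = trans (cong (1# +_) (fromℕ-+ b c)) (sym (+-assoc _ _ _))

  private
    floor-below : ∀ {z} b → (∀ c → fromℕ c ≤ z → c ℕ.< suc b) → fromℕ 0 ≤ z →
                  Σ ℕ λ m → fromℕ m ≤ z × (∀ c → fromℕ c ≤ z → c ℕ.≤ m)
    floor-below zero bound 0≤z = 0 , 0≤z , λ c p → ℕₚ.≤-pred (bound c p)
    floor-below {z} (suc b) bound 0≤z with <⊎≥ z (fromℕ (suc b))
    ... | inj₂ p = suc b , p , λ c q → ℕₚ.≤-pred (bound c q)
    ... | inj₁ z<b = floor-below b smaller 0≤z
      where
      smaller : ∀ c → fromℕ c ≤ z → c ℕ.< suc b
      smaller c p with c ℕₚ.<? suc b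
      ... | yes q = q
      ... | no q = ⊥-elim (<⇒≱ z<b (≤-trans (fromℕ-mono (ℕₚ.≮⇒≥ q)) p))

  -- The field may be non-Archimedean, so the search for the integer part descends from a given
  -- upper bound `b`. For `εn` the size of a cluster serves as `b`.
  floor : ∀ {z} b → 0# ≤ z → z < fromℕ b →
          Σ ℕ λ m → fromℕ m ≤ z × (∀ c → fromℕ c ≤ z → c ℕ.≤ m)
  floor {z} b 0≤z z<b = floor-below b below 0≤z
    where
    below : ∀ c → fromℕ c ≤ z → c ℕ.< suc b
    below c p with c ℕₚ.<? suc b
    ... | yes q = q
    ... | no q = ⊥-elim (<⇒≱ z<b (≤-trans (fromℕ-mono (ℕₚ.≤-trans (ℕₚ.n≤1+n b) (ℕₚ.≮⇒≥ q))) p))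

  double<fromℕ : ∀ {z} m b → fromℕ m ≤ z → double z < fromℕ b → m ℕ.+ m ℕ.< b
  double<fromℕ {z} m b m≤z 2z<b with (m ℕ.+ m) ℕₚ.<? b
  ... | yes p = p
  ... | no p = ⊥-elim (<⇒≱ 2z<b (≤-trans (fromℕ-mono (ℕₚ.≮⇒≥ p))
                 (subst (_≤ double z) (sym (fromℕ-+ m m)) (+-mono-≤ m≤z m≤z))))

-- Sizes of subsets under union, insertion and deletion.

∣p∪q∣≤∣p∣+∣q∣ : ∀ {n} (p q : Subset n) → ∣ p ∪ q ∣ ℕ.≤ ∣ p ∣ ℕ.+ ∣ q ∣
∣p∪q∣≤∣p∣+∣q∣ [] [] = z≤n
∣p∪q∣≤∣p∣+∣q∣ (outside ∷ p) (outside ∷ q) = ∣p∪q∣≤∣p∣+∣q∣ p q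
∣p∪q∣≤∣p∣+∣q∣ (outside ∷ p) (inside ∷ q) = subst (suc ∣ p ∪ q ∣ ℕ.≤_) (sym (ℕₚ.+-suc ∣ p ∣ ∣ q ∣)) (s≤s (∣p∪q∣≤∣p∣+∣q∣ p q))
∣p∪q∣≤∣p∣+∣q∣ (inside ∷ p) (outside ∷ q) = s≤s (∣p∪q∣≤∣p∣+∣q∣ p q)
∣p∪q∣≤∣p∣+∣q∣ (inside ∷ p) (inside ∷ q) =
  s≤s (ℕₚ.≤-trans (∣p∪q∣≤∣p∣+∣q∣ p q) (ℕₚ.+-monoʳ-≤ ∣ p ∣ (ℕₚ.n≤1+n ∣ q ∣)))

∣q∣<∣p∣⇒∃∈p∉q : ∀ {n} {p q : Subset n} → ∣ q ∣ ℕ.< ∣ p ∣ → Σ (Fin n) λ x → x ∈ p × x ∉ q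
∣q∣<∣p∣⇒∃∈p∉q {p = p} {q} q<p with any? (λ x → (x ∈? p) ×-dec ¬? (x ∈? q))
... | yes w = w
... | no ¬w = contradiction (p⊆q⇒∣p∣≤∣q∣ p⊆q) (ℕₚ.<⇒≱ q<p)
  where
  p⊆q : p ⊆ q
  p⊆q {x} x∈p = decidable-stable (x ∈? q) λ x∉q → ¬w (x , x∈p , x∉q)

insert delete : ∀ {n} → Fin n → Subset n → Subset n
insert x p = p [ x ]≔ inside
delete x p = p [ x ]≔ outside

module _ {n : ℕ} where
  x∈insert : ∀ (x : Fin n) p → x ∈ insert x p
  x∈insert x p = []≔-updates p x

  private
    ∈-update : ∀ {x y : Fin n} {s} p → x ≢ y → y ∈ p → y ∈ (p [ x ]≔ s)
    ∈-update p x≢y y∈p = lookup⇒[]= _ _ (trans (lookup∘update′ (x≢y ∘ sym) p _) ([]=⇒lookup y∈p))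

    ∈-update⁻ : ∀ {x y : Fin n} {s} p → x ≢ y → y ∈ (p [ x ]≔ s) → y ∈ p
    ∈-update⁻ p x≢y y∈p = lookup⇒[]= _ _ (trans (sym (lookup∘update′ (x≢y ∘ sym) p _)) ([]=⇒lookup y∈p))

  ∈-insert : ∀ {x y : Fin n} {p} → y ∈ p → y ∈ insert x p
  ∈-insert {x} {y} {p} y∈p with x ≟ y
  ... | yes refl = x∈insert x p
  ... | no x≢y = ∈-update p x≢y y∈p

  ∈-insert⁻ : ∀ {x y : Fin n} {p} → y ∈ insert x p → y ≡ x ⊎ y ∈ p
  ∈-insert⁻ {x} {y} {p} y∈ with x ≟ y
  ... | yes refl = inj₁ refl
  ... | no x≢y = inj₂ (∈-update⁻ p x≢y y∈)

  ∈-delete : ∀ {x y : Fin n} {p} → y ∈ p → y ≢ x → y ∈ delete x p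
  ∈-delete {p = p} y∈p y≢x = ∈-update p (y≢x ∘ sym) y∈p

  ∈-delete⁻ : ∀ {x y : Fin n} {p} → y ∈ delete x p → y ∈ p × y ≢ x
  ∈-delete⁻ {x} {y} {p} y∈ with x ≟ y
  ... | no x≢y = ∈-update⁻ p x≢y y∈ , x≢y ∘ sym
  ... | yes refl with () ← trans (sym (lookup∘update x p outside)) ([]=⇒lookup y∈)

∣insert∣ : ∀ {n} (x : Fin n) p → x ∉ p → ∣ insert x p ∣ ≡ suc ∣ p ∣
∣insert∣ Fin.zero (outside ∷ p) x∉ = refl
∣insert∣ Fin.zero (inside ∷ p) x∉ = contradiction here x∉
∣insert∣ (Fin.suc x) (outside ∷ p) x∉ = ∣insert∣ x p (x∉ ∘ there)
∣insert∣ (Fin.suc x) (inside ∷ p) x∉ = cong suc (∣insert∣ x p (x∉ ∘ there))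

∣delete∣ : ∀ {n} (x : Fin n) p → x ∈ p → suc ∣ delete x p ∣ ≡ ∣ p ∣
∣delete∣ Fin.zero (inside ∷ p) here = refl
∣delete∣ (Fin.suc x) (outside ∷ p) (there x∈) = ∣delete∣ x p x∈
∣delete∣ (Fin.suc x) (inside ∷ p) (there x∈) = cong suc (∣delete∣ x p x∈)

-- Least elements of total preorders, and membership in clusters.

least : ∀ {n} {R : Fin n → Fin n → Set} {P : Fin n → Set} →
        (∀ x y → R x y ⊎ R y x) → (∀ {x y z} → R x y → R y z → R x z) →
        (∀ x → Dec (P x)) → ∀ x₀ → P x₀ → Σ (Fin n) λ x → P x × (∀ y → P y → R x y)
least {n} {R} {P} R-total R-trans P? x₀ Px₀ = let x , Px , _ , least-x = go (allFin n) in
  x , Px , λ y → least-x y (∈-allFin y)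
  where
  R-refl : ∀ x → R x x
  R-refl x = [ (λ r → r) , (λ r → r) ]′ (R-total x x)

  go : (ys : List (Fin n)) → Σ (Fin n) λ x → P x × R x x₀ × (∀ y → y List.∈ ys → P y → R x y)
  go [] = x₀ , Px₀ , R-refl x₀ , λ _ ()
  go (z ∷ ys) with go ys | P? z
  ... | x , Px , x₀≤ , leastx | no ¬Pz = x , Px , x₀≤ ,
    λ { y (here refl) Py → contradiction Py ¬Pz ; y (there y∈) Py → leastx y y∈ Py }
  ... | x , Px , x₀≤ , leastx | yes Pz with R-total x z
  ...   | inj₁ x≤z = x , Px , x₀≤ , λ { y (here refl) Py → x≤z ; y (there y∈) Py → leastx y y∈ Py }
  ...   | inj₂ z≤x = z , Pz , R-trans z≤x x₀≤ ,
    λ { y (here refl) Py → R-refl z ; y (there y∈) Py → R-trans z≤x (leastx y y∈ Py) }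

module _ {n : ℕ} (F : OrderedField) where
  open KCenter F using (cluster)

  ∈-cluster : ∀ {a : Fin n → Fin n} {c v} → a v ≡ c → v ∈ cluster a c
  ∈-cluster {a} {c} {v} av≡c = lookup⇒[]= _ _ (trans (lookup∘tabulate _ v) yes-inside)
    where
    yes-inside : ⌊ a v ≟ c ⌋ ≡ inside
    yes-inside with a v ≟ c
    ... | yes _ = refl
    ... | no av≢c = contradiction av≡c av≢c

  ∈-cluster⁻ : ∀ {a : Fin n → Fin n} {c v} → v ∈ cluster a c → a v ≡ c
  ∈-cluster⁻ {a} {c} {v} v∈ with a v ≟ c | trans (sym (lookup∘tabulate (λ v → ⌊ a v ≟ c ⌋) v)) ([]=⇒lookup v∈)
  ... | yes av≡c | _ = av≡c
  ... | no _ | ()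

-- Captors of resilient clusters.

module LocalResilience (F : OrderedField) where
  open OrderedField F
  open KCenter F
  open OrderedFieldProperties F

  record Setting : Set where
    no-eta-equality
    field
      {n k} : ℕ
      d : Dist n
      metric : IsMetric d
      X : Subset n
      r : Carrier
      optimal : IsOptimalCenters k d X r
      a : Fin n → Fin n
      voronoi : IsVoronoi d X a
      ε : Carrier
      m : ℕ
      floor-ε : ∀ c → fromℕ c ≤ ε * fromℕ n → c ℕ.≤ m
      large : ∀ {c} → c ∈ X → m ℕ.+ m ℕ.< ∣ cluster a c ∣
      0<r : 0# < r

  module Captors (S : Setting) where
    open Setting S
    open IsMetric metric renaming (sym to d-sym)

    a∈X : ∀ v → a v ∈ X
    a∈X v = proj₁ (voronoi v)

    a-nearest : ∀ v {c} → c ∈ X → d v (a v) ≤ d v c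
    a-nearest v = proj₂ (voronoi v) _

    a-within : ∀ v → d v (a v) ≤ r
    a-within v = let _ , c∈X , dvc≤r = proj₁ (proj₁ (proj₂ optimal)) v in
      ≤-trans (a-nearest v c∈X) dvc≤r

    a-fix : ∀ {c} → c ∈ X → a c ≡ c
    a-fix {c} c∈X = sym (zero-iff c (a c)
      (≤-antisym (≤-trans (a-nearest c c∈X) (≤-reflexive (refl0 c))) (nonneg c (a c))))

    triangle-≤ : ∀ {u w x y} v → d u v ≤ x → d v w ≤ y → d u w ≤ x + y
    triangle-≤ {u} {w} v p q = ≤-trans (triangle u v w) (+-mono-≤ p q)

    within-sym : ∀ {u v x} → d u v ≤ x → d v u ≤ x
    within-sym {u} {v} = subst (_≤ _) (d-sym u v)

    same-cluster : ∀ {u v x} → a u ≡ x → a v ≡ x → d u v ≤ double r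
    same-cluster {u} {v} refl av≡au =
      triangle-≤ (a u) (a-within u) (within-sym (subst (λ c → d v c ≤ r) av≡au (a-within v)))

    -- Computing the cost of Z for d turns optimality of X into a point far from all of Z.
    far-point : ∀ Z → ∣ Z ∣ ≡ k → Σ (Fin n) λ v → ∀ z → z ∈ Z → r ≤ d v z
    far-point Z ∣Z∣≡k with any? (_∈? Z)
    ... | no Z-empty = proj₁ (proj₂ (proj₁ (proj₂ optimal))) , λ z z∈Z → contradiction (z , z∈Z) Z-empty
    ... | yes (z₀ , z₀∈Z) = farthest , λ z z∈Z → ≤-trans r≤cost (proj₂ (proj₂ (nearest farthest)) z z∈Z)
      where
      nearest : ∀ v → Σ (Fin n) λ z → z ∈ Z × (∀ y → y ∈ Z → d v z ≤ d v y)
      nearest v = least {R = λ x y → d v x ≤ d v y} (λ x y → ≤-total _ _) ≤-trans (_∈? Z) z₀ z₀∈Z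
      dist : Fin n → Carrier
      dist v = d v (proj₁ (nearest v))
      max : Σ (Fin n) λ v → v ≡ v × (∀ w → w ≡ w → dist w ≤ dist v)
      max = least {R = λ x y → dist y ≤ dist x} (λ x y → ≤-total _ _) (λ p q → ≤-trans q p) (λ v → v ≟ v) z₀ refl
      farthest : Fin n
      farthest = proj₁ max
      r≤cost : r ≤ dist farthest
      r≤cost = proj₂ (proj₂ optimal) Z (dist farthest) ∣Z∣≡k
        ( (λ v → proj₁ (nearest v) , proj₁ (proj₂ (nearest v)) , proj₂ (proj₂ max) v refl)
        , farthest , proj₂ (proj₂ (nearest farthest)))

    -- The exceptional set itself is recorded, so that two such facts about one cluster combine by a
    -- union of exceptions.
    Most : ℕ → Fin n → (Fin n → Set) → Set
    Most b x P = Σ (Subset n) λ E → ∣ E ∣ ℕ.≤ b × (∀ v → a v ≡ x → v ∉ E → P v)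

    Most-map : ∀ {b x} {P Q : Fin n → Set} → (∀ v → a v ≡ x → P v → Q v) → Most b x P → Most b x Q
    Most-map f (E , E≤b , p) = E , E≤b , λ v av≡x v∉E → f v av≡x (p v av≡x v∉E)

    Most-× : ∀ {b c x} {P Q : Fin n → Set} → Most b x P → Most c x Q → Most (b ℕ.+ c) x (λ v → P v × Q v)
    Most-× (E , E≤b , p) (E′ , E′≤c , q) =
      E ∪ E′ , ℕₚ.≤-trans (∣p∪q∣≤∣p∣+∣q∣ E E′) (ℕₚ.+-mono-≤ E≤b E′≤c) ,
      λ v av≡x v∉ → p v av≡x (v∉ ∘ x∈p∪q⁺ ∘ inj₁) , q v av≡x (v∉ ∘ x∈p∪q⁺ ∘ inj₂)

    Most-all : ∀ {b x} {P : Fin n → Set} → (∀ v → a v ≡ x → P v) → Most b x P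
    Most-all p = Subset.⊥ , subst (ℕ._≤ _) (sym (∣⊥∣≡0 n)) z≤n , λ v av≡x _ → p v av≡x

    Most-≢ : ∀ x y → Most 1 x (_≢ y)
    Most-≢ x y = ⁅ y ⁆ , ℕₚ.≤-reflexive (∣⁅x⁆∣≡1 y) , λ { _ _ v∉ refl → v∉ (x∈⁅x⁆ y) }

    0≤r : 0# ≤ r
    0≤r = proj₁ 0<r

    Resilient : Fin n → Set
    Resilient x = LocallyPR k d (1# + 1# + 1#) ε (cluster a x)

    -- Clusters have more than `m + m` points, so two exceptional sets of at most `m` points cannot
    -- exhaust one. The contradictions between captors rest on this count.
    Most-∃ : ∀ {b x} {P : Fin n → Set} → x ∈ X → b ℕ.≤ m ℕ.+ m → Most b x P →
             Σ (Fin n) λ v → a v ≡ x × P v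
    Most-∃ x∈X b≤2m (E , E≤b , p) =
      let v , v∈C , v∉E = ∣q∣<∣p∣⇒∃∈p∉q (ℕₚ.≤-<-trans (ℕₚ.≤-trans E≤b b≤2m) (large x∈X))
          av≡x = ∈-cluster⁻ F v∈C
      in v , av≡x , p v av≡x v∉E

    meet : ∀ {x} {P Q : Fin n → Set} → x ∈ X → Most m x P → Most m x Q →
           Σ (Fin n) λ v → a v ≡ x × P v × Q v
    meet x∈X p q = Most-∃ x∈X ℕₚ.≤-refl (Most-× p q)

    some : ∀ {x} {P : Fin n → Set} → x ∈ X → Most m x P → Σ (Fin n) λ v → a v ≡ x × P v
    some x∈X p = Most-∃ x∈X (ℕₚ.m≤m+n m m) p

    clash : ∀ {x} {P Q : Fin n → Set} → x ∈ X → Most m x P → Most m x Q → (∀ v → P v → ¬ Q v) → ⊥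
    clash x∈X p q ¬pq = let v , _ , pv , qv = meet x∈X p q in ¬pq v pv qv

    -- This is what closeness of the new cluster of `captor` to the old cluster of `x` yields, once
    -- missing and extra points are told apart. In `captures-strictly` the captor itself is an extra
    -- point, which leaves at most `m - 1` missing ones.
    record Captor (A : Fin n → Fin n) (Y : Subset n) (x : Fin n) : Set where
      field
        captor : Fin n
        captor∈Y : captor ∈ Y
        captures : Most m x (λ v → A v ≡ captor)
        nothing-else : ∀ {l} → l ≢ x → Most m l (λ v → A v ≢ captor)
        captures-strictly : a captor ≢ x → A captor ≡ captor →
          Σ ℕ λ b → b ℕ.< m × Most b x (λ v → A v ≡ captor)

    open Captor public

    -- A common captor would take all but `m` points of the cluster of `x` and, as captor for `x′`,
    -- at most `m` of them.
    captor-injective : ∀ {A Y x x′} (c : Captor A Y x) (c′ : Captor A Y x′) →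
                       x ∈ X → x ≢ x′ → captor c ≢ captor c′
    captor-injective c c′ x∈X x≢x′ eq =
      clash x∈X (captures c) (nothing-else c′ x≢x′) (λ v Av≡ Av≢ → Av≢ (trans Av≡ eq))

    -- The perturbation is L v between v and its target A v and 3 d everywhere else.  No k-set gets
    -- cheaper than R, since each k-set leaves some point at distance at least r from all its members.
    private
      perturb-proof : ∀ {x} → Resilient x → (Y : Subset n) → ∣ Y ∣ ≡ k →
        (A : Fin n → Fin n) (L : Fin n → Carrier) (R : Carrier) →
        (∀ v → A v ∈ Y) → (∀ v → d v (A v) ≤ L v) → (∀ v → L v ≤ triple (d v (A v))) →
        R ≤ triple r → (∀ v → L v ≤ R) → (∀ v → r ≤ d v (A v) → R ≤ L v) →
        (∀ v y → y ∈ Y → L v ≤ triple (d v y)) →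
        Captor A Y x
      perturb-proof {x} resilient Y ∣Y∣≡k A L R A∈Y d≤L L≤3d R≤3r L≤R R≤L L≤3dy = result
        where
        d′ : Dist n
        d′ v t with t ≟ A v
        ... | yes _ = L v
        ... | no _ = triple (d v t)

        d′-A : ∀ v → d′ v (A v) ≡ L v
        d′-A v with A v ≟ A v
        ... | yes _ = refl
        ... | no ≢ = contradiction refl ≢

        pert : IsPerturbation (1# + 1# + 1#) d d′
        pert v t with t ≟ A v
        ... | yes refl = d≤L v , subst (L v ≤_) (sym (triple-* _)) (L≤3d v)
        ... | no _ = x≤triple (nonneg v t) , ≤-reflexive (sym (triple-* _))

        far : ∀ v t → r ≤ d v t → R ≤ d′ v t
        far v t r≤d with t ≟ A v
        ... | yes refl = R≤L v r≤d
        ... | no _ = ≤-trans R≤3r (triple-mono r≤d)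

        far-from : ∀ Z → ∣ Z ∣ ≡ k → Σ (Fin n) λ v → ∀ z → z ∈ Z → R ≤ d′ v z
        far-from Z ∣Z∣≡k = let v , r≤ = far-point Z ∣Z∣≡k in v , λ z z∈Z → far v z (r≤ z z∈Z)

        A-nearest : ∀ v y → y ∈ Y → L v ≤ d′ v y
        A-nearest v y y∈Y with y ≟ A v
        ... | yes _ = ≤-refl
        ... | no _ = L≤3dy v y y∈Y

        clustering : OptClustering k d′
        clustering = record
          { centers = Y
          ; radius = R
          ; assign = A
          ; optimal = ∣Y∣≡k
              , ((λ v → A v , A∈Y v , subst (_≤ R) (sym (d′-A v)) (L≤R v)) , far-from Y ∣Y∣≡k)
              , λ Z s ∣Z∣≡k cost → let v , R≤ = far-from Z ∣Z∣≡k
                                       z , z∈Z , d′≤s = proj₁ cost v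
                                   in ≤-trans (R≤ z z∈Z) d′≤s
          ; voronoi = λ v → A∈Y v , λ y y∈Y → subst (_≤ d′ v y) (sym (d′-A v)) (A-nearest v y y∈Y)
          }

        close = resilient d′ pert clustering
        y = proj₁ close
        extra = cluster A y ─ cluster a x
        missing = cluster a x ─ cluster A y

        extra+missing≤m : ∣ extra ∣ ℕ.+ ∣ missing ∣ ℕ.≤ m
        extra+missing≤m = floor-ε _ (proj₂ (proj₂ close))

        present : ∀ v → a v ≡ x → v ∉ missing → A v ≡ y
        present v av≡x v∉ with A v ≟ y
        ... | yes p = p
        ... | no p = contradiction (x∈p∧x∉q⇒x∈p─q (∈-cluster F av≡x) (p ∘ ∈-cluster⁻ F)) v∉

        result : Captor A Y x
        result = record
          { captor = y
          ; captor∈Y = proj₁ (proj₂ close)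
          ; captures = missing , ℕₚ.≤-trans (ℕₚ.m≤n+m _ _) extra+missing≤m , present
          ; nothing-else = λ l≢x → extra , ℕₚ.≤-trans (ℕₚ.m≤m+n _ _) extra+missing≤m ,
              λ { v refl v∉ Av≡y → v∉ (x∈p∧x∉q⇒x∈p─q (∈-cluster F Av≡y) (l≢x ∘ ∈-cluster⁻ F)) }
          ; captures-strictly = λ ay≢x Ay≡y →
              let y∈extra = x∈p∧x∉q⇒x∈p─q (∈-cluster F Ay≡y) (ay≢x ∘ ∈-cluster⁻ F)
              in ∣ missing ∣
               , ℕₚ.≤-trans (ℕₚ.+-monoˡ-≤ ∣ missing ∣ (subst (1 ℕ.≤_) (∣delete∣ y extra y∈extra) (s≤s z≤n)))
                            extra+missing≤m
               , missing , ℕₚ.≤-refl , present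
          }

    abstract
      perturb : ∀ {x} → Resilient x → (Y : Subset n) → ∣ Y ∣ ≡ k →
        (A : Fin n → Fin n) (L : Fin n → Carrier) (R : Carrier) →
        (∀ v → A v ∈ Y) → (∀ v → d v (A v) ≤ L v) → (∀ v → L v ≤ triple (d v (A v))) →
        R ≤ triple r → (∀ v → L v ≤ R) → (∀ v → r ≤ d v (A v) → R ≤ L v) →
        (∀ v y → y ∈ Y → L v ≤ triple (d v y)) →
        Captor A Y x
      perturb = perturb-proof

    -- The case R = r: X itself stays optimal when points move to a center that is within r
    -- and at most three times as far away as their own.
    isolated : ∀ {x} → x ∈ X → Resilient x →
      Most m x (λ v → ∀ c → c ∈ X → c ≢ x → d v c ≤ r → ¬ (d v c ≤ triple (d v x)))
    isolated {x} x∈X resilient = result (captor cap ≟ x)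
      where
      Stealable : Fin n → Fin n → Set
      Stealable v c = c ∈ X × c ≢ x × d v c ≤ r × d v c ≤ triple (d v x)

      target : ∀ v → Σ (Fin n) λ t →
        (t ∈ X × d v t ≤ r × d v t ≤ triple (d v (a v))) ×
        ((t ≡ a v × (a v ≡ x → ∀ c → ¬ Stealable v c)) ⊎ (a v ≡ x × t ≢ x))
      target v with a v ≟ x
      ... | no av≢x = a v , (a∈X v , a-within v , x≤triple (nonneg _ _)) , inj₁ (refl , λ av≡x → contradiction av≡x av≢x)
      ... | yes refl with any? (λ c → (c ∈? X) ×-dec (¬? (c ≟ x) ×-dec ((d v c ≤? r) ×-dec (d v c ≤? triple (d v x)))))
      ...   | yes (c , c∈X , c≢x , c≤r , c≤3) = c , (c∈X , c≤r , c≤3) , inj₂ (refl , c≢x)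
      ...   | no none = a v , (a∈X v , a-within v , x≤triple (nonneg _ _)) , inj₁ (refl , λ _ c s → none (c , s))

      A : Fin n → Fin n
      A v = proj₁ (target v)

      cap : Captor A X x
      cap = perturb resilient X (proj₁ optimal) A (λ v → d v (A v)) r
        (λ v → proj₁ (proj₁ (proj₂ (target v)))) (λ _ → ≤-refl) (λ _ → x≤triple (nonneg _ _))
        (x≤triple 0≤r) (λ v → proj₁ (proj₂ (proj₁ (proj₂ (target v))))) (λ _ p → p)
        (λ v y y∈X → ≤-trans (proj₂ (proj₂ (proj₁ (proj₂ (target v))))) (triple-mono (a-nearest v y∈X)))

      not-stolen : captor cap ≡ x → ∀ v → a v ≡ x → A v ≡ captor cap → ∀ c → ¬ Stealable v c
      not-stolen cap≡x v av≡x Av≡ with proj₂ (proj₂ (target v))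
      ... | inj₁ (_ , none) = none av≡x
      ... | inj₂ (_ , Av≢x) = contradiction (trans Av≡ cap≡x) Av≢x

      stays : ∀ v → a v ≢ x → A v ≡ a v
      stays v av≢x with proj₂ (proj₂ (target v))
      ... | inj₁ (Av≡av , _) = Av≡av
      ... | inj₂ (av≡x , _) = contradiction av≡x av≢x

      result : Dec (captor cap ≡ x) → _
      result (yes cap≡x) = Most-map
        (λ v av≡x Av≡ c c∈X c≢x c≤r c≤3 → not-stolen cap≡x v av≡x Av≡ c (c∈X , c≢x , c≤r , c≤3)) (captures cap)
      -- Another center as captor would have to lose most of its own cluster, but no point outside
      -- the cluster of `x` moves.
      result (no cap≢x) = let v , av≡ , Av≢ = some (captor∈Y cap) (nothing-else cap cap≢x) in
        contradiction (trans (stays v (λ av≡x → cap≢x (trans (sym av≡) av≡x))) av≡) Av≢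

    -- Preferences of a point between candidate centers.

    κ : Fin n → Fin n → ℕ
    κ v t with t ≟ a v
    ... | yes _ = 0
    ... | no _ = suc (toℕ t)

    κ-injective : ∀ v {t t′} → κ v t ≡ κ v t′ → t ≡ t′
    κ-injective v {t} {t′} eq with t ≟ a v | t′ ≟ a v
    ... | yes p | yes q = trans p (sym q)
    ... | no _ | no _ = toℕ-injective (ℕₚ.suc-injective eq)
    κ-injective v () | yes _ | no _
    κ-injective v () | no _ | yes _

    κ-center : ∀ v → κ v (a v) ≡ 0
    κ-center v with a v ≟ a v
    ... | yes _ = refl
    ... | no ≢ = contradiction refl ≢

    -- Ties go to the own center first, since the Voronoi assignment a may break them arbitrarily.
    infix 4 _⊢_⊑_
    _⊢_⊑_ : Fin n → Fin n → Fin n → Set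
    v ⊢ t ⊑ t′ = d v t < d v t′ ⊎ (d v t ≡ d v t′ × κ v t ℕ.≤ κ v t′)

    ⊑-total : ∀ v t t′ → v ⊢ t ⊑ t′ ⊎ v ⊢ t′ ⊑ t
    ⊑-total v t t′ with <⊎≥ (d v t) (d v t′)
    ... | inj₁ p = inj₁ (inj₁ p)
    ... | inj₂ p with <⊎≥ (d v t′) (d v t)
    ...   | inj₁ q = inj₂ (inj₁ q)
    ...   | inj₂ q with ℕₚ.≤-total (κ v t) (κ v t′)
    ...     | inj₁ s = inj₁ (inj₂ (≤-antisym q p , s))
    ...     | inj₂ s = inj₂ (inj₂ (≤-antisym p q , s))

    ⊑⇒≤ : ∀ {v t t′} → v ⊢ t ⊑ t′ → d v t ≤ d v t′
    ⊑⇒≤ (inj₁ p) = proj₁ p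
    ⊑⇒≤ (inj₂ (p , _)) = ≤-reflexive p

    ⊑-trans : ∀ {v t t′ t″} → v ⊢ t ⊑ t′ → v ⊢ t′ ⊑ t″ → v ⊢ t ⊑ t″
    ⊑-trans (inj₁ p) q = inj₁ (<-≤-trans p (⊑⇒≤ q))
    ⊑-trans p@(inj₂ _) (inj₁ q) = inj₁ (≤-<-trans (⊑⇒≤ p) q)
    ⊑-trans (inj₂ (p , s)) (inj₂ (q , t)) = inj₂ (trans p q , ℕₚ.≤-trans s t)

    ⊑-antisym : ∀ {v t t′} → v ⊢ t ⊑ t′ → v ⊢ t′ ⊑ t → t ≡ t′
    ⊑-antisym (inj₁ p) q = contradiction (⊑⇒≤ q) (<⇒≱ p)
    ⊑-antisym p@(inj₂ _) (inj₁ q) = contradiction (⊑⇒≤ p) (<⇒≱ q)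
    ⊑-antisym {v} (inj₂ (_ , s)) (inj₂ (_ , t)) = κ-injective v (ℕₚ.≤-antisym s t)

    center-⊑ : ∀ v {c} → c ∈ X → v ⊢ a v ⊑ c
    center-⊑ v {c} c∈X with <⊎≥ (d v (a v)) (d v c)
    ... | inj₁ p = inj₁ p
    ... | inj₂ p = inj₂ (≤-antisym (a-nearest v c∈X) p , subst (ℕ._≤ κ v c) (sym (κ-center v)) z≤n)

    -- Only preferences for points nearer than r bind: all distances in [r , 3r] may be perturbed to the common value 3r.
    record Prefers (v y y′ : Fin n) : Set where
      constructor prefers
      field
        ≢ : y ≢ y′
        ⊑ : v ⊢ y ⊑ y′
        near : d v y < r

    prefers-asym : ∀ {v y y′} → Prefers v y y′ → ¬ Prefers v y′ y
    prefers-asym (prefers y≢y′ y⊑y′ _) (prefers _ y′⊑y _) = y≢y′ (⊑-antisym y⊑y′ y′⊑y)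

    prefers-≤ : ∀ {v y y′} → Prefers v y y′ → d v y ≤ r
    prefers-≤ p = proj₁ (Prefers.near p)

    center-unbeaten : ∀ {v c} → c ∈ X → ¬ Prefers v c (a v)
    center-unbeaten {v} c∈X (prefers c≢ c⊑ _) = c≢ (⊑-antisym c⊑ (center-⊑ v c∈X))

    -- Clusterings induced by sets that cover everything within `3r`.

    abstract
      top : ∀ Y {y₀} → y₀ ∈ Y → ∀ v → Σ (Fin n) λ y → y ∈ Y × (∀ y′ → y′ ∈ Y → v ⊢ y ⊑ y′)
      top Y y₀∈Y v = least {R = v ⊢_⊑_} (⊑-total v) ⊑-trans (_∈? Y) _ y₀∈Y

    -- `φ` is the fallback of points that have no member of `Y` nearer than `r`. Any member within
    -- `3r` may play this role, and the exchanges below choose it to their advantage.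
    record Cover (Y : Subset n) : Set where
      field
        size : ∣ Y ∣ ≡ k
        φ : Fin n → Fin n
        φ∈Y : ∀ v → φ v ∈ Y
        φ-within : ∀ v → d v (φ v) ≤ triple r

      private
        best : ∀ v → Σ (Fin n) λ y → y ∈ Y × (∀ y′ → y′ ∈ Y → v ⊢ y ⊑ y′)
        best v = top Y (φ∈Y v) v

        choice : ∀ v → Σ (Fin n) λ y →
          (d v y < r × y ∈ Y × (∀ y′ → y′ ∈ Y → v ⊢ y ⊑ y′)) ⊎
          (y ≡ φ v × (∀ y′ → y′ ∈ Y → r ≤ d v y′))
        choice v with best v
        ... | y , y∈Y , y⊑ with <⊎≥ (d v y) r
        ...   | inj₁ near = y , inj₁ (near , y∈Y , y⊑)
        ...   | inj₂ far = φ v , inj₂ (refl , λ y′ y′∈Y → ≤-trans far (⊑⇒≤ (y⊑ y′ y′∈Y)))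

      assign : Fin n → Fin n
      assign v = proj₁ (choice v)

      assign∈Y : ∀ v → assign v ∈ Y
      assign∈Y v with proj₂ (choice v)
      ... | inj₁ (_ , y∈Y , _) = y∈Y
      ... | inj₂ (eq , _) = subst (_∈ Y) (sym eq) (φ∈Y v)

      assign-within : ∀ v → d v (assign v) ≤ triple r
      assign-within v with proj₂ (choice v)
      ... | inj₁ (near , _) = ≤-trans (proj₁ near) (x≤triple 0≤r)
      ... | inj₂ (eq , _) = subst (λ y → d v y ≤ triple r) (sym eq) (φ-within v)

      assign-optimal : ∀ v y → y ∈ Y → d v (assign v) ≤ d v y ⊎ r ≤ d v y
      assign-optimal v y y∈Y with proj₂ (choice v)
      ... | inj₁ (_ , _ , y⊑) = inj₁ (⊑⇒≤ (y⊑ y y∈Y))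
      ... | inj₂ (_ , far) = inj₂ (far y y∈Y)

      -- A point not assigned to its fallback was assigned by distance, so its choice reveals a
      -- preference.
      assign-prefers : ∀ {v y y′} → assign v ≡ y → y ≢ φ v → y′ ∈ Y → y ≢ y′ → Prefers v y y′
      assign-prefers {v} refl y≢φ y′∈Y y≢y′ with proj₂ (choice v)
      ... | inj₁ (near , _ , y⊑) = prefers y≢y′ (y⊑ _ y′∈Y) near
      ... | inj₂ (y≡φ , _) = contradiction y≡φ y≢φ

      assign-near : ∀ {v y} → assign v ≡ y → y ≢ φ v → d v y < r
      assign-near {v} refl y≢φ with proj₂ (choice v)
      ... | inj₁ (near , _) = near
      ... | inj₂ (y≡φ , _) = contradiction y≡φ y≢φ

      assign-unbeaten : ∀ {v y y′} → assign v ≡ y → y′ ∈ Y → ¬ Prefers v y′ y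
      assign-unbeaten {v} refl y′∈Y (prefers y′≢ y′⊑ near) with proj₂ (choice v)
      ... | inj₁ (_ , _ , y⊑) = y′≢ (⊑-antisym y′⊑ (y⊑ _ y′∈Y))
      ... | inj₂ (_ , far) = <⇒≱ near (far _ y′∈Y)

      assign-top : ∀ {v y} → y ∈ Y → d v y < r → (∀ y′ → y′ ∈ Y → v ⊢ y ⊑ y′) → assign v ≡ y
      assign-top {v} {y} y∈Y near y⊑ with proj₂ (choice v)
      ... | inj₁ (_ , t∈Y , t⊑) = ⊑-antisym (t⊑ y y∈Y) (y⊑ _ t∈Y)
      ... | inj₂ (_ , far) = contradiction (far y y∈Y) (<⇒≱ near)

      assign-self : ∀ {y} → y ∈ Y → assign y ≡ y
      assign-self {y} y∈Y with proj₂ (choice y)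
      ... | inj₁ (_ , t∈Y , t⊑) = sym (zero-iff y _ (≤-antisym (≤-trans (⊑⇒≤ (t⊑ y y∈Y)) (≤-reflexive (refl0 y))) (nonneg _ _)))
      ... | inj₂ (_ , far) = contradiction (≤-trans (far y y∈Y) (≤-reflexive (refl0 y))) (<⇒≱ 0<r)

      -- Among centers the own one comes first, so only a noncenter can draw `v` away from it.
      assign-home : ∀ {v} → a v ∈ Y → φ v ≡ a v → assign v ≢ a v → assign v ∉ X × Prefers v (assign v) (a v)
      assign-home {v} av∈Y φ≡ ≢ = (λ ∈X → center-unbeaten ∈X p) , p
        where
        p : Prefers v (assign v) (a v)
        p = assign-prefers refl (λ eq → ≢ (trans eq φ≡)) av∈Y ≢

      -- The distance to the assigned member becomes `3d` below `r` and `3r` otherwise. A point sent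
      -- to its fallback has all members of `Y` at distance `r` or more, so none is cheaper than
      -- `3r` after tripling.
      capture : ∀ {x} → Resilient x → Captor assign Y x
      capture resilient = perturb resilient Y size assign L (triple r)
        assign∈Y d≤L L≤3d ≤-refl L≤R R≤L L≤3dy
        where
        L : Fin n → Carrier
        L v with <⊎≥ (d v (assign v)) r
        ... | inj₁ _ = triple (d v (assign v))
        ... | inj₂ _ = triple r

        d≤L : ∀ v → d v (assign v) ≤ L v
        d≤L v with <⊎≥ (d v (assign v)) r
        ... | inj₁ _ = x≤triple (nonneg _ _)
        ... | inj₂ _ = assign-within v

        L≤3d : ∀ v → L v ≤ triple (d v (assign v))
        L≤3d v with <⊎≥ (d v (assign v)) r
        ... | inj₁ _ = ≤-refl
        ... | inj₂ far = triple-mono far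

        L≤R : ∀ v → L v ≤ triple r
        L≤R v with <⊎≥ (d v (assign v)) r
        ... | inj₁ near = triple-mono (proj₁ near)
        ... | inj₂ _ = ≤-refl

        R≤L : ∀ v → r ≤ d v (assign v) → triple r ≤ L v
        R≤L v far with <⊎≥ (d v (assign v)) r
        ... | inj₁ _ = triple-mono far
        ... | inj₂ _ = ≤-refl

        L≤3dy : ∀ v y → y ∈ Y → L v ≤ triple (d v y)
        L≤3dy v y y∈Y with assign-optimal v y y∈Y
        ... | inj₁ le = ≤-trans (L≤3d v) (triple-mono le)
        ... | inj₂ far = ≤-trans (L≤R v) (triple-mono far)

    -- Exchanging some centers for new points.

    exchange : List (Fin n) → List (Fin n) → Subset n
    exchange R Q = foldr insert (foldr delete X R) Q

    ∈-deletes : ∀ {R y} → y ∈ X → y List.∉ R → y ∈ foldr delete X R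
    ∈-deletes {[]} y∈X _ = y∈X
    ∈-deletes {x ∷ R} y∈X y∉ = ∈-delete (∈-deletes y∈X (y∉ ∘ there)) (y∉ ∘ here)

    ∈-deletes⁻ : ∀ {R y} → y ∈ foldr delete X R → y ∈ X × y List.∉ R
    ∈-deletes⁻ {[]} y∈ = y∈ , λ ()
    ∈-deletes⁻ {x ∷ R} y∈ with ∈-delete⁻ y∈
    ... | y∈′ , y≢x with ∈-deletes⁻ {R} y∈′
    ...   | y∈X , y∉R = y∈X , λ { (here eq) → y≢x eq ; (there p) → y∉R p }

    new∈exchange : ∀ {R Q y} → y List.∈ Q → y ∈ exchange R Q
    new∈exchange {Q = q ∷ Q} (here refl) = x∈insert q _
    new∈exchange {R} {q ∷ Q} (there y∈) = ∈-insert {x = q} (new∈exchange {R} y∈)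

    kept∈exchange : ∀ {R} Q {y} → y ∈ X → y List.∉ R → y ∈ exchange R Q
    kept∈exchange [] y∈X y∉R = ∈-deletes y∈X y∉R
    kept∈exchange (q ∷ Q) y∈X y∉R = ∈-insert {x = q} (kept∈exchange Q y∈X y∉R)

    ∈-exchange⁻ : ∀ {R} Q {y} → y ∈ exchange R Q → y List.∈ Q ⊎ (y ∈ X × y List.∉ R)
    ∈-exchange⁻ [] y∈ = inj₂ (∈-deletes⁻ y∈)
    ∈-exchange⁻ (q ∷ Q) y∈ with ∈-insert⁻ y∈
    ... | inj₁ eq = inj₁ (here eq)
    ... | inj₂ y∈′ with ∈-exchange⁻ Q y∈′
    ...   | inj₁ p = inj₁ (there p)
    ...   | inj₂ p = inj₂ p

    ∣deletes∣ : ∀ {R} → Unique R → All (_∈ X) R → ∣ foldr delete X R ∣ ℕ.+ length R ≡ k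
    ∣deletes∣ [] [] = trans (ℕₚ.+-identityʳ _) (proj₁ optimal)
    ∣deletes∣ {x ∷ R} (x∉ ∷ uniq) (x∈X ∷ R⊆X) = begin
      ∣ delete x D ∣ ℕ.+ suc (length R)  ≡⟨ ℕₚ.+-suc _ _ ⟩
      suc ∣ delete x D ∣ ℕ.+ length R    ≡⟨ cong (ℕ._+ length R) (∣delete∣ x D (∈-deletes x∈X λ x∈R → All.lookup x∉ x∈R refl)) ⟩
      ∣ D ∣ ℕ.+ length R                 ≡⟨ ∣deletes∣ uniq R⊆X ⟩
      k                                  ∎
      where
      open ≡-Reasoning
      D = foldr delete X R

    -- A new point may be a center if it is among those removed, in which case it is put back.
    ∣exchange∣ : ∀ R Q → Unique Q → All (λ q → q ∈ X → q List.∈ R) Q →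
                 ∣ exchange R Q ∣ ≡ length Q ℕ.+ ∣ foldr delete X R ∣
    ∣exchange∣ R [] [] [] = refl
    ∣exchange∣ R (q ∷ Q) (q∉ ∷ uniq) (fresh ∷ freshes) =
      trans (∣insert∣ q _ q∉′) (cong suc (∣exchange∣ R Q uniq freshes))
      where
      q∉′ : q ∉ exchange R Q
      q∉′ q∈ with ∈-exchange⁻ Q q∈
      ... | inj₁ q∈Q = All.lookup q∉ q∈Q refl
      ... | inj₂ (q∈X , q∉R) = q∉R (fresh q∈X)

    ∣exchange∣≡k : ∀ {R Q} → Unique R → All (_∈ X) R → Unique Q → All (λ q → q ∈ X → q List.∈ R) Q →
                   length R ≡ length Q → ∣ exchange R Q ∣ ≡ k
    ∣exchange∣≡k {R} {Q} uniqR R⊆X uniqQ fresh eq = begin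
      ∣ exchange R Q ∣                     ≡⟨ ∣exchange∣ R Q uniqQ fresh ⟩
      length Q ℕ.+ ∣ foldr delete X R ∣    ≡⟨ cong (ℕ._+ ∣ foldr delete X R ∣) (sym eq) ⟩
      length R ℕ.+ ∣ foldr delete X R ∣    ≡⟨ ℕₚ.+-comm (length R) _ ⟩
      ∣ foldr delete X R ∣ ℕ.+ length R    ≡⟨ ∣deletes∣ uniqR R⊆X ⟩
      k                                    ∎
      where open ≡-Reasoning

    redirect : List (Fin n × Fin n) → Fin n → Fin n
    redirect [] c = c
    redirect ((x , f) ∷ L) c with c ≟ x
    ... | yes _ = f
    ... | no _ = redirect L c

    redirect-key : ∀ {L x f} → Unique (map proj₁ L) → (x , f) List.∈ L → redirect L x ≡ f
    redirect-key {(x , f) ∷ L} _ (here refl) with x ≟ x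
    ... | yes _ = refl
    ... | no ≢ = contradiction refl ≢
    redirect-key {(x , f) ∷ L} {x′} (x∉ ∷ uniq) (there p) with x′ ≟ x
    ... | yes refl = contradiction refl (All.lookup x∉ (∈-map⁺ proj₁ p))
    ... | no _ = redirect-key uniq p

    redirect-spec : ∀ L c → (c , redirect L c) List.∈ L ⊎ (c List.∉ map proj₁ L × redirect L c ≡ c)
    redirect-spec [] c = inj₂ ((λ ()) , refl)
    redirect-spec ((x , f) ∷ L) c with c ≟ x
    ... | yes refl = inj₁ (here refl)
    ... | no c≢x with redirect-spec L c
    ...   | inj₁ p = inj₁ (there p)
    ...   | inj₂ (c∉ , eq) = inj₂ ((λ { (here e) → c≢x e ; (there p) → c∉ p }) , eq)

    -- For (x , f) in L the center x is removed, and points of its cluster with nothing nearer than r go to f.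
    record Exchange (L : List (Fin n × Fin n)) (Q : List (Fin n)) : Set where
      field
        centers-unique : Unique (map proj₁ L)
        centers∈X : All (λ e → proj₁ e ∈ X) L
        new-unique : Unique Q
        new-fresh : All (λ q → q ∈ X → q List.∈ map proj₁ L) Q
        lengths : length L ≡ length Q
        fallback-new : All (λ e → proj₂ e List.∈ Q) L
        fallback-covers : All (λ e → ∀ v → a v ≡ proj₁ e → d v (proj₂ e) ≤ triple r) L

      Y : Subset n
      Y = exchange (map proj₁ L) Q

      new : ∀ {y} → y List.∈ Q → y ∈ Y
      new = new∈exchange {map proj₁ L}

      kept : ∀ {c} → c ∈ X → c List.∉ map proj₁ L → c ∈ Y
      kept = kept∈exchange Q

      cover : Cover Y
      cover = record
        { size = ∣exchange∣≡k centers-unique (All-map⁺ centers∈X) new-unique new-fresh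
                   (trans (length-map proj₁ L) lengths)
        ; φ = redirect L ∘ a
        ; φ∈Y = φ∈Y
        ; φ-within = φ-within
        }
        where
        φ∈Y : ∀ v → redirect L (a v) ∈ Y
        φ∈Y v with redirect-spec L (a v)
        ... | inj₁ p = new (All.lookup fallback-new p)
        ... | inj₂ (av∉ , eq) = subst (_∈ Y) (sym eq) (kept (a∈X v) av∉)

        φ-within : ∀ v → d v (redirect L (a v)) ≤ triple r
        φ-within v with redirect-spec L (a v)
        ... | inj₁ p = All.lookup fallback-covers p v refl
        ... | inj₂ (_ , eq) = subst (λ c → d v c ≤ triple r) (sym eq) (≤-trans (a-within v) (x≤triple 0≤r))

      open Cover cover public using (assign; assign-self; assign∈Y; assign-top; assign-home)

      φ-removed : ∀ {x f v} → (x , f) List.∈ L → a v ≡ x → redirect L (a v) ≡ f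
      φ-removed p refl = redirect-key centers-unique p

      Capture : Fin n → Set
      Capture = Captor assign Y

      capture : ∀ {x} → Resilient x → Capture x
      capture = Cover.capture cover

      beats : ∀ {x f y y′} → (x , f) List.∈ L → (c : Capture x) → captor c ≡ y → y ≢ f → y′ ∈ Y → y ≢ y′ →
              Most m x (λ v → Prefers v y y′)
      beats p c refl ≢f y′∈Y ≢y′ = Most-map
        (λ v av≡x eq → Cover.assign-prefers cover eq (λ e → ≢f (trans e (φ-removed p av≡x))) y′∈Y ≢y′) (captures c)

      unbeaten : ∀ {x y y′} (c : Capture x) → captor c ≡ y → y′ ∈ Y → Most m x (λ v → ¬ Prefers v y′ y)
      unbeaten c refl y′∈Y = Most-map (λ v _ eq → Cover.assign-unbeaten cover eq y′∈Y) (captures c)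

      nearby : ∀ {x f y} → (x , f) List.∈ L → (c : Capture x) → captor c ≡ y → y ≢ f → Most m x (λ v → d v y ≤ r)
      nearby p c refl ≢f = Most-map
        (λ v av≡x eq → proj₁ (Cover.assign-near cover eq (λ e → ≢f (trans e (φ-removed p av≡x))))) (captures c)

      kept≢new : ∀ {y q} → y ∈ X → y List.∉ map proj₁ L → q List.∈ Q → y ≢ q
      kept≢new y∈X y∉ q∈Q refl = y∉ (All.lookup new-fresh q∈Q y∈X)

      Kept : Fin n → Set
      Kept y = y ∈ X × y List.∉ map proj₁ L

      kept≢removed : ∀ {x f y} → (x , f) List.∈ L → Kept y → y ≢ x
      kept≢removed p (_ , y∉) refl = y∉ (∈-map⁺ proj₁ p)

      new-or-kept : ∀ {x} (c : Capture x) → captor c List.∈ Q ⊎ Kept (captor c)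
      new-or-kept c = ∈-exchange⁻ Q (captor∈Y c)

      -- Fallbacks are new points, so a kept captor is no fallback and has won the cluster by
      -- preference.
      kept-beats : ∀ {x f q} → (x , f) List.∈ L → (c : Capture x) → Kept (captor c) → q List.∈ Q →
                   Most m x (λ v → Prefers v (captor c) q)
      kept-beats p c (c∈X , c∉) q∈Q =
        beats p c refl (kept≢new c∈X c∉ (All.lookup fallback-new p)) (new q∈Q) (kept≢new c∈X c∉ q∈Q)

    -- Clusters covered by other centers, and the case where no resilient one is.

    Covered : Fin n → Set
    Covered x = ∀ v → a v ≡ x → Σ (Fin n) λ c → c ∈ X × c ≢ x × d v c ≤ triple r

    reaches : ∀ {x y} → x ∈ X → Most m x (λ v → d v y ≤ r) → d y x ≤ double r
    reaches x∈X near = let v , av≡x , dvy≤r = some x∈X near in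
      triangle-≤ v (within-sym dvy≤r) (subst (λ c → d v c ≤ r) av≡x (a-within v))

    -- Points of one cluster are at most `2r` apart, and one of them is within `r` of `y`.
    reaches-cluster : ∀ {x y} → x ∈ X → Most m x (λ v → d v y ≤ r) → ∀ v → a v ≡ x → d v y ≤ triple r
    reaches-cluster x∈X near v av≡x = let w , aw≡x , dwy≤r = some x∈X near in
      triangle-≤ w (same-cluster av≡x aw≡x) dwy≤r

    -- Bounds obtained by inserting a point as a new center are lacking for centers; a center
    -- borrows the bound of a cluster member at the price of `r`.
    via-sibling : ∀ {w c v} → a v ≡ w → d v c ≤ double r → d w c ≤ triple r
    via-sibling {w} {c} {v} av≡w le = subst (d w c ≤_) (IsCommutativeRing.+-comm isCommutativeRing r (double r))
      (triangle-≤ v (within-sym (subst (λ c → d v c ≤ r) av≡w (a-within v))) le)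

    center≢ : ∀ {v x} → a v ≡ x → v ≢ x → v ∉ X
    center≢ refl v≢av v∈X = v≢av (sym (a-fix v∈X))

    module _ {L Q} (E : Exchange L Q) where
      open Exchange E

      kept-covers : ∀ {x f} → x ∈ X → (x , f) List.∈ L → (c : Capture x) → Kept (captor c) → Covered x
      kept-covers x∈X p c (c∈X , c∉) v av≡x =
        captor c , c∈X , (λ { refl → c∉ (∈-map⁺ proj₁ p) }) ,
        reaches-cluster x∈X (nearby p c refl (kept≢new c∈X c∉ (All.lookup fallback-new p))) v av≡x

      captor-new : ∀ {x f} → x ∈ X → ¬ Covered x → (x , f) List.∈ L → (c : Capture x) → captor c List.∈ Q
      captor-new x∈X ¬cov p c with new-or-kept c
      ... | inj₁ c∈Q = c∈Q
      ... | inj₂ kc = contradiction (kept-covers x∈X p c kc) ¬cov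

    -- Since u covers the clusters of i and j, the centers i and j may be replaced by u and any p;
    -- with no other center in reach, p then captures one of the two clusters and u the other.
    module Indispensable {i j z : Fin n} (i∈X : i ∈ X) (j∈X : j ∈ X) (z∈X : z ∈ X)
      (i≢j : i ≢ j) (i≢z : i ≢ z) (j≢z : j ≢ z)
      (resᵢ : Resilient i) (resⱼ : Resilient j) (res-z : Resilient z)
      (¬covᵢ : ¬ Covered i) (¬covⱼ : ¬ Covered j) (¬cov-z : ¬ Covered z)
      {z′ : Fin n} (az′≡z : a z′ ≡ z) (z′≢z : z′ ≢ z)
      {u : Fin n} (au≡i : a u ≡ i) (u-coversⱼ : ∀ v → a v ≡ j → d v u ≤ triple r) where

      u∉X : u ∉ X
      u∉X u∈X = ¬covⱼ λ v av≡j → u , u∈X , (λ { refl → i≢j (trans (sym au≡i) (a-fix u∈X)) }) , u-coversⱼ v av≡j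

      Takesᵢ Takesⱼ : Fin n → Set
      Takesᵢ p = Most m i (λ v → Prefers v p u) × Most m j (λ v → ¬ Prefers v p u)
      Takesⱼ p = Most m i (λ v → ¬ Prefers v p u) × Most m j (λ v → Prefers v p u)

      takes : ∀ {p} → a p ≡ z → p ≢ z → Takesᵢ p ⊎ Takesⱼ p
      takes {p} ap≡z p≢z = by-captors (captor-new E i∈X ¬covᵢ (here refl) cᵢ) (captor-new E j∈X ¬covⱼ (there (here refl)) cⱼ)
        where
        p∉X : p ∉ X
        p∉X = center≢ ap≡z p≢z
        u≢p : u ≢ p
        u≢p refl = i≢z (trans (sym au≡i) ap≡z)
        E : Exchange ((i , u) ∷ (j , u) ∷ []) (u ∷ p ∷ [])
        E = record
          { centers-unique = (i≢j ∷ []) ∷ [] ∷ []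
          ; centers∈X = i∈X ∷ j∈X ∷ []
          ; new-unique = (u≢p ∷ []) ∷ [] ∷ []
          ; new-fresh = ⊥-elim ∘ u∉X ∷ ⊥-elim ∘ p∉X ∷ []
          ; lengths = refl
          ; fallback-new = here refl ∷ here refl ∷ []
          ; fallback-covers = (λ v av≡i → ≤-trans (same-cluster av≡i au≡i) (double≤triple 0≤r)) ∷ u-coversⱼ ∷ []
          }
        open Exchange E
        cᵢ = capture resᵢ
        cⱼ = capture resⱼ
        by-captors : captor cᵢ List.∈ u ∷ p ∷ [] → captor cⱼ List.∈ u ∷ p ∷ [] → Takesᵢ p ⊎ Takesⱼ p
        by-captors (here eqᵢ) (here eqⱼ) = contradiction (trans eqᵢ (sym eqⱼ)) (captor-injective cᵢ cⱼ i∈X i≢j)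
        by-captors (here eqᵢ) (there (here eqⱼ)) = inj₂
          (unbeaten cᵢ eqᵢ (new (there (here refl))) , beats (there (here refl)) cⱼ eqⱼ (u≢p ∘ sym) (new (here refl)) (u≢p ∘ sym))
        by-captors (there (here eqᵢ)) (here eqⱼ) = inj₁
          (beats (here refl) cᵢ eqᵢ (u≢p ∘ sym) (new (here refl)) (u≢p ∘ sym) , unbeaten cⱼ eqⱼ (new (there (here refl))))
        by-captors (there (here eqᵢ)) (there (here eqⱼ)) = contradiction (trans eqᵢ (sym eqⱼ)) (captor-injective cᵢ cⱼ i∈X i≢j)

      module _ {p q} (ap≡z : a p ≡ z) (p≢z : p ≢ z) (aq≡z : a q ≡ z) (q≢z : q ≢ z)
               (takesᵢ : Takesᵢ p) (takesⱼ : Takesⱼ q) where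
        p≢q : p ≢ q
        p≢q refl = clash i∈X (proj₁ takesᵢ) (proj₁ takesⱼ) λ v s ¬s → ¬s s

        -- `p` covers the cluster of `i` as well as its own, that of `z`, and `q` covers that of
        -- `j`. The third new point `t` is therefore arbitrary.
        triple-exchange : ∀ {t} → (t ∈ X → t List.∈ i ∷ j ∷ z ∷ []) → p ≢ t → q ≢ t →
          Exchange ((i , p) ∷ (j , q) ∷ (z , p) ∷ []) (p ∷ q ∷ t ∷ [])
        triple-exchange fresh p≢t q≢t = record
          { centers-unique = (i≢j ∷ i≢z ∷ []) ∷ (j≢z ∷ []) ∷ [] ∷ []
          ; centers∈X = i∈X ∷ j∈X ∷ z∈X ∷ []
          ; new-unique = (p≢q ∷ p≢t ∷ []) ∷ (q≢t ∷ []) ∷ [] ∷ []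
          ; new-fresh = ⊥-elim ∘ center≢ ap≡z p≢z ∷ ⊥-elim ∘ center≢ aq≡z q≢z ∷ fresh ∷ []
          ; lengths = refl
          ; fallback-new = here refl ∷ there (here refl) ∷ here refl ∷ []
          ; fallback-covers =
              reaches-cluster i∈X (Most-map (λ _ _ → prefers-≤) (proj₁ takesᵢ)) ∷
              reaches-cluster j∈X (Most-map (λ _ _ → prefers-≤) (proj₂ takesⱼ)) ∷
              (λ v av≡z → ≤-trans (same-cluster av≡z ap≡z) (double≤triple 0≤r)) ∷ []
          }

        -- Take `t = u`. On the cluster of `i`, `q` does not beat `u`, and `u` does not beat `p`, so
        -- the captor is `p` and `q` fails to beat it. The argument for `j` is symmetric.
        i-rejects-q : Most m i (λ v → ¬ Prefers v q p)
        j-rejects-p : Most m j (λ v → ¬ Prefers v p q)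
        i-rejects-q = by-captor (captor-new E i∈X ¬covᵢ (here refl) c)
          where
          E = triple-exchange (⊥-elim ∘ u∉X) (λ { refl → i≢z (trans (sym au≡i) ap≡z) }) (λ { refl → i≢z (trans (sym au≡i) aq≡z) })
          open Exchange E
          c = capture resᵢ
          q≢u : q ≢ u
          q≢u refl = i≢z (trans (sym au≡i) aq≡z)
          u≢p : u ≢ p
          u≢p refl = i≢z (trans (sym au≡i) ap≡z)
          by-captor : captor c List.∈ p ∷ q ∷ u ∷ [] → _
          by-captor (here eq) = unbeaten c eq (new (there (here refl)))
          by-captor (there (here eq)) = ⊥-elim (clash i∈X
            (beats (here refl) c eq (p≢q ∘ sym) (new (there (there (here refl)))) q≢u) (proj₁ takesⱼ) λ v s ¬s → ¬s s)
          by-captor (there (there (here eq))) = ⊥-elim (clash i∈X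
            (beats (here refl) c eq u≢p (new (here refl)) u≢p) (proj₁ takesᵢ) λ v → prefers-asym)
        j-rejects-p = by-captor (captor-new E j∈X ¬covⱼ (there (here refl)) c)
          where
          E = triple-exchange (⊥-elim ∘ u∉X) (λ { refl → i≢z (trans (sym au≡i) ap≡z) }) (λ { refl → i≢z (trans (sym au≡i) aq≡z) })
          open Exchange E
          c = capture resⱼ
          u≢q : u ≢ q
          u≢q refl = i≢z (trans (sym au≡i) aq≡z)
          p≢u : p ≢ u
          p≢u refl = i≢z (trans (sym au≡i) ap≡z)
          by-captor : captor c List.∈ p ∷ q ∷ u ∷ [] → _
          by-captor (here eq) = ⊥-elim (clash j∈X
            (beats (there (here refl)) c eq p≢q (new (there (there (here refl)))) p≢u) (proj₂ takesᵢ) λ v s ¬s → ¬s s)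
          by-captor (there (here eq)) = unbeaten c eq (new (here refl))
          by-captor (there (there (here eq))) = ⊥-elim (clash j∈X
            (beats (there (here refl)) c eq u≢q (new (there (here refl))) u≢q) (proj₂ takesⱼ) λ v → prefers-asym)

        -- If `p` captures the cluster of `z`, it is lost to `i`, whose cluster rejects `q` and
        -- falls to `t`. If `q` does, the cluster of `j` falls to `t` likewise.
        outcome : ∀ {t} → (t ∈ X → t List.∈ i ∷ j ∷ z ∷ []) → p ≢ t → q ≢ t →
          Most m z (λ v → d v t ≤ r) ⊎
          (Most m i (λ v → d v t ≤ r) × Most m z (λ v → ¬ Prefers v q p)) ⊎
          (Most m j (λ v → d v t ≤ r) × Most m z (λ v → Prefers v q p))
        outcome {t} fresh p≢t q≢t = by-captors (captor-new E z∈X ¬cov-z (there (there (here refl))) c)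
            (captor-new E i∈X ¬covᵢ (here refl) cᵢ) (captor-new E j∈X ¬covⱼ (there (here refl)) cⱼ)
          where
          E = triple-exchange fresh p≢t q≢t
          open Exchange E
          c = capture res-z
          cᵢ = capture resᵢ
          cⱼ = capture resⱼ
          by-captors : captor c List.∈ p ∷ q ∷ t ∷ [] → captor cᵢ List.∈ p ∷ q ∷ t ∷ [] → captor cⱼ List.∈ p ∷ q ∷ t ∷ [] → _
          by-captors (there (there (here eq))) _ _ = inj₁ (nearby (there (there (here refl))) c eq (p≢t ∘ sym))
          by-captors (here eq) (here eqᵢ) _ = contradiction (trans eqᵢ (sym eq)) (captor-injective cᵢ c i∈X i≢z)
          by-captors (here eq) (there (here eqᵢ)) _ = ⊥-elim (clash i∈X
            (beats (here refl) cᵢ eqᵢ (p≢q ∘ sym) (new (here refl)) (p≢q ∘ sym)) i-rejects-q λ v s ¬s → ¬s s)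
          by-captors (here eq) (there (there (here eqᵢ))) _ = inj₂ (inj₁
            (nearby (here refl) cᵢ eqᵢ (p≢t ∘ sym) , unbeaten c eq (new (there (here refl)))))
          by-captors (there (here eq)) _ (here eqⱼ) = ⊥-elim (clash j∈X
            (beats (there (here refl)) cⱼ eqⱼ p≢q (new (there (here refl))) p≢q) j-rejects-p λ v s ¬s → ¬s s)
          by-captors (there (here eq)) _ (there (here eqⱼ)) = contradiction (trans eqⱼ (sym eq)) (captor-injective cⱼ c j∈X j≢z)
          by-captors (there (here eq)) _ (there (there (here eqⱼ))) = inj₂ (inj₂
            (nearby (there (here refl)) cⱼ eqⱼ (q≢t ∘ sym) , beats (there (there (here refl))) c eq (p≢q ∘ sym) (new (here refl)) (p≢q ∘ sym)))

        -- The preference of `z` between `p` and `q` does not depend on `t`. If it favours `q`,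
        -- letting `t` run through the cluster of `i` shows that this cluster is covered; otherwise
        -- the same holds for `j`.
        not-both : ⊥
        not-both = ¬covⱼ λ t at≡j → coverⱼ t at≡j
            (outcome (λ t∈X → there (here (trans (sym (a-fix t∈X)) at≡j)))
              (λ { refl → j≢z (trans (sym at≡j) ap≡z) }) (λ { refl → j≢z (trans (sym at≡j) aq≡z) }))
          where
          within : ∀ {c} t → c ∈ X → Most m c (λ v → d v t ≤ r) → d t c ≤ triple r
          within t c∈X near = ≤-trans (reaches c∈X near) (double≤triple 0≤r)

          z-not-q : ¬ Most m z (λ v → Prefers v q p)
          z-not-q over = ¬covᵢ λ t at≡i → coverᵢ t
              (outcome (λ t∈X → here (trans (sym (a-fix t∈X)) at≡i))
                (λ { refl → i≢z (trans (sym at≡i) ap≡z) }) (λ { refl → i≢z (trans (sym at≡i) aq≡z) }))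
            where
            coverᵢ : ∀ t → _ → Σ (Fin n) λ c → c ∈ X × c ≢ i × d t c ≤ triple r
            coverᵢ t (inj₁ near) = z , z∈X , i≢z ∘ sym , within t z∈X near
            coverᵢ t (inj₂ (inj₁ (_ , not-over))) = ⊥-elim (clash z∈X over not-over λ v s ¬s → ¬s s)
            coverᵢ t (inj₂ (inj₂ (near , _))) = j , j∈X , i≢j ∘ sym , within t j∈X near

          coverⱼ : ∀ t → a t ≡ j → _ → Σ (Fin n) λ c → c ∈ X × c ≢ j × d t c ≤ triple r
          coverⱼ t _ (inj₁ near) = z , z∈X , j≢z ∘ sym , within t z∈X near
          coverⱼ t _ (inj₂ (inj₁ (near , _))) = i , i∈X , i≢j , within t i∈X near
          coverⱼ t _ (inj₂ (inj₂ (_ , over))) = contradiction over z-not-q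

      reach-z : ∀ {x} → x ∈ X → x ≢ z → (∀ p → a p ≡ z → p ≢ z → Most m x (λ v → d v p ≤ r)) → Covered z
      reach-z {x} x∈X x≢z near p ap≡z with p ≟ z
      ... | no p≢z = x , x∈X , x≢z , ≤-trans (reaches x∈X (near p ap≡z p≢z)) (double≤triple 0≤r)
      ... | yes refl = x , x∈X , x≢z , via-sibling az′≡z (reaches x∈X (near z′ az′≡z z′≢z))

      -- By `not-both` all noncenters in the cluster of `z` take the same one of the two clusters,
      -- and the center of that one then covers the cluster of `z`.
      absurd : ⊥
      absurd = ¬cov-z (reach-z j∈X j≢z λ q aq≡z q≢z → side-j q (takes aq≡z q≢z) (takes-no-i aq≡z q≢z))
        where
        takes-no-i : ∀ {p} → a p ≡ z → p ≢ z → ¬ Takesᵢ p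
        takes-no-i ap≡z p≢z takesᵢ = ¬cov-z (reach-z i∈X i≢z λ q aq≡z q≢z →
          side-i q (takes aq≡z q≢z) (not-both ap≡z p≢z aq≡z q≢z takesᵢ))
          where
          side-i : ∀ q → Takesᵢ q ⊎ Takesⱼ q → ¬ Takesⱼ q → Most m i (λ v → d v q ≤ r)
          side-i q (inj₁ s) _ = Most-map (λ _ _ → prefers-≤) (proj₁ s)
          side-i q (inj₂ s) ¬s = contradiction s ¬s
        side-j : ∀ q → Takesᵢ q ⊎ Takesⱼ q → ¬ Takesᵢ q → Most m j (λ v → d v q ≤ r)
        side-j q (inj₁ s) ¬s = contradiction s ¬s
        side-j q (inj₂ s) _ = Most-map (λ _ _ → prefers-≤) (proj₂ s)

    -- When p replaces x, either p captures the cluster of x, or the runner-up t does and p takes over that of t.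
    Wins : Fin n → Fin n → Set
    Wins x p = (∀ c → c ∈ X → c ≢ x → Most m x (λ v → Prefers v p c)) × Most m x (λ v → d v p ≤ r) ×
             (∀ l → l ≢ x → Most m l (λ v → ¬ Prefers v p l))

    record Loses (x p t : Fin n) : Set where
      field
        t∈X : t ∈ X
        t≢x : t ≢ x
        first : Most m x (λ v → ∀ c → c ∈ X → c ≢ x → v ⊢ t ⊑ c)
        not-preferred : Most m x (λ v → ¬ Prefers v p t)
        steals : Most m t (λ v → Prefers v p t)
        target-not-resilient : Resilient t → ∀ {l} → l ∈ X → l ≢ t → l ≢ x → ¬ Most m l (λ v → Prefers v p l)

    -- Replacing a single covered center.

    module Dichotomy {x w : Fin n} (x∈X : x ∈ X) (w∈X : w ∈ X) (w≢x : w ≢ x) (cov : Covered x) where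

      module _ {p : Fin n} (p∉X : p ∉ X) (C : Cover (exchange (x ∷ []) (p ∷ [])))
               (φ∈X : ∀ v → Cover.φ C v ∈ X) (φ≢x : ∀ v → Cover.φ C v ≢ x)
               (φ-⊑ : ∀ v {c} → c ∈ X → c ≢ x → v ⊢ Cover.φ C v ⊑ c) (res : Resilient x) where
        private
          Y = exchange (x ∷ []) (p ∷ [])
        open Cover C using (φ; assign; assign∈Y; assign-prefers; assign-near; assign-unbeaten; assign-top; assign-home; capture)

        φ-own : ∀ {v} → a v ≢ x → φ v ≡ a v
        φ-own {v} av≢x = ⊑-antisym (φ-⊑ v (a∈X v) av≢x) (center-⊑ v (φ∈X v))

        kept : ∀ {y} → y ∈ X → y ≢ x → y ∈ Y
        kept y∈X y≢x = kept∈exchange {x ∷ []} (p ∷ []) y∈X λ { (here eq) → y≢x eq }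

        members : ∀ {y} → y ∈ Y → y ≡ p ⊎ (y ∈ X × y ≢ x)
        members y∈Y with ∈-exchange⁻ {x ∷ []} (p ∷ []) y∈Y
        ... | inj₁ (here eq) = inj₁ eq
        ... | inj₂ (y∈X , y∉) = inj₂ (y∈X , y∉ ∘ here)

        p∈Y : p ∈ Y
        p∈Y = x∈insert p _

        c = capture res

        p≢φ : ∀ v → p ≢ φ v
        p≢φ v eq = p∉X (subst (_∈ X) (sym eq) (φ∈X v))

        p≢∈X : ∀ {y} → y ∈ X → p ≢ y
        p≢∈X y∈X refl = p∉X y∈X

        won : ∀ {v} → a v ≢ x → Prefers v p (a v) → assign v ≡ p
        won {v} av≢x (prefers _ p⊑av near) = assign-top p∈Y near p⊑
          where
          p⊑ : ∀ y → y ∈ Y → v ⊢ p ⊑ y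
          p⊑ y y∈Y with members y∈Y
          ... | inj₁ refl = inj₂ (refl , ℕₚ.≤-refl)
          ... | inj₂ (y∈X , _) = ⊑-trans p⊑av (center-⊑ v y∈X)

        stolen : ∀ {v} → a v ≢ x → assign v ≢ a v → assign v ≡ p × Prefers v p (a v)
        stolen {v} av≢x A≢ = by-member (members (assign∈Y v)) (assign-home (kept (a∈X v) av≢x) (φ-own av≢x) A≢)
          where
          by-member : assign v ≡ p ⊎ (assign v ∈ X × assign v ≢ x) → assign v ∉ X × Prefers v (assign v) (a v) → _
          by-member (inj₁ eq) (_ , pref) = eq , subst (λ y → Prefers v y (a v)) eq pref
          by-member (inj₂ (∈X , _)) (∉X , _) = contradiction ∈X ∉X

        wins : captor c ≡ p → Wins x p
        wins eq =
          (λ t t∈X t≢x → Most-map (λ v _ e → assign-prefers (trans e eq) (p≢φ v) (kept t∈X t≢x) (p≢∈X t∈X)) (captures c)) ,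
          Most-map (λ v _ e → proj₁ (assign-near (trans e eq) (p≢φ v))) (captures c) ,
          λ l l≢x → Most-map (λ { v refl A≢ pref → A≢ (trans (won l≢x pref) (sym eq)) }) (nothing-else c l≢x)

        -- The captor `t` for `x` can hold only few points of its own cluster. The others left a
        -- center still present, and only `p` can have drawn them away.
        loses : captor c ∈ X → captor c ≢ x → Loses x p (captor c)
        loses t∈X t≢x = record
          { t∈X = t∈X
          ; t≢x = t≢x
          ; first = Most-map first (captures c)
          ; not-preferred = Most-map (λ v _ e → assign-unbeaten e p∈Y) (captures c)
          ; steals = Most-map (λ { v av≡t A≢ → subst (Prefers v p) av≡t
              (proj₂ (stolen (λ av≡x → t≢x (trans (sym av≡t) av≡x)) (λ e → A≢ (trans e av≡t)))) }) (nothing-else c t≢x)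
          ; target-not-resilient = no-target
          }
          where
          first : ∀ v → a v ≡ x → assign v ≡ captor c → ∀ y → y ∈ X → y ≢ x → v ⊢ captor c ⊑ y
          first v av≡x e y y∈X y≢x = compare (captor c ≟ y) (captor c ≟ φ v)
            where
            compare : Dec (captor c ≡ y) → Dec (captor c ≡ φ v) → _
            compare (yes eq) _ = subst (λ t → v ⊢ t ⊑ y) (sym eq) (inj₂ (refl , ℕₚ.≤-refl))
            compare (no _) (yes eq) = subst (λ t → v ⊢ t ⊑ y) (sym eq) (φ-⊑ v y∈X y≢x)
            compare (no t≢y) (no t≢φ) = Prefers.⊑ (assign-prefers e t≢φ (kept y∈X y≢x) t≢y)

          -- Points of the cluster of `t` stay with `t`, which already captures for `x`, or go to
          -- `p`. So `p` captures for `t` and cannot also hold most of the cluster of `l`.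
          no-target : Resilient (captor c) → ∀ {l} → l ∈ X → l ≢ captor c → l ≢ x → ¬ Most m l (λ v → Prefers v p l)
          no-target res-t {l} l∈X l≢t l≢x steals-l = by-target (members (captor∈Y c′))
            where
            c′ = capture res-t
            by-target : captor c′ ≡ p ⊎ (captor c′ ∈ X × captor c′ ≢ x) → ⊥
            by-target (inj₁ eq) = clash l∈X
              (Most-map (λ { v refl pref → won l≢x pref }) steals-l) (nothing-else c′ l≢t) λ v e ≢ → ≢ (trans e (sym eq))
            by-target (inj₂ (y∈X , _)) = let v , av≡t , e = some t∈X (captures c′) in by-home v av≡t e (assign v ≟ a v)
              where
              by-home : ∀ v → a v ≡ captor c → assign v ≡ captor c′ → Dec (assign v ≡ a v) → ⊥
              by-home v av≡t e (yes Av≡av) = captor-injective c c′ x∈X (t≢x ∘ sym) (trans (sym av≡t) (trans (sym Av≡av) e))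
              by-home v av≡t e (no Av≢av) =
                p∉X (subst (_∈ X) (trans (sym e) (proj₁ (stolen (λ av≡x → t≢x (trans (sym av≡t) av≡x)) Av≢av))) y∈X)

        wins-or-loses : Wins x p ⊎ Σ (Fin n) (Loses x p)
        wins-or-loses with members (captor∈Y c)
        ... | inj₁ eq = inj₁ (wins eq)
        ... | inj₂ (t∈X , t≢x) = inj₂ (captor c , loses t∈X t≢x)

      -- With the first remaining center as fallback, points outside the cluster of `x` move only to
      -- `p`. The fallback is within `3r` because `x` is covered, and `w` shows that some center
      -- remains.
      dichotomy : Resilient x → ∀ {p} → p ∉ X → Wins x p ⊎ Σ (Fin n) (Loses x p)
      dichotomy res {p} p∉X = wins-or-loses p∉X C rest∈X rest≢x rest-⊑ res
        where
        rest : Fin n → Fin n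
        rest v = proj₁ (top (delete x X) (∈-delete w∈X w≢x) v)

        rest∈X : ∀ v → rest v ∈ X
        rest∈X v = proj₁ (∈-delete⁻ (proj₁ (proj₂ (top (delete x X) (∈-delete w∈X w≢x) v))))

        rest≢x : ∀ v → rest v ≢ x
        rest≢x v = proj₂ (∈-delete⁻ (proj₁ (proj₂ (top (delete x X) (∈-delete w∈X w≢x) v))))

        rest-⊑ : ∀ v {c} → c ∈ X → c ≢ x → v ⊢ rest v ⊑ c
        rest-⊑ v c∈X c≢x = proj₂ (proj₂ (top (delete x X) (∈-delete w∈X w≢x) v)) _ (∈-delete c∈X c≢x)

        rest-within : ∀ v → d v (rest v) ≤ triple r
        rest-within v with a v ≟ x
        ... | yes av≡x = let c , c∈X , c≢x , le = cov v av≡x in ≤-trans (⊑⇒≤ (rest-⊑ v c∈X c≢x)) le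
        ... | no av≢x = ≤-trans (⊑⇒≤ (rest-⊑ v (a∈X v) av≢x)) (≤-trans (a-within v) (x≤triple 0≤r))

        C : Cover (exchange (x ∷ []) (p ∷ []))
        C = record
          { size = ∣exchange∣≡k ([] ∷ []) (x∈X ∷ []) ([] ∷ []) (⊥-elim ∘ p∉X ∷ []) refl
          ; φ = rest
          ; φ∈Y = λ v → kept∈exchange {x ∷ []} (p ∷ []) (rest∈X v) λ { (here eq) → rest≢x v eq }
          ; φ-within = rest-within
          }

    -- Twins of centers, and why no replacement of a covered center loses.

    module NonDegenerate (0<m : 0 ℕ.< m) where

      sibling : ∀ {x} → x ∈ X → Σ (Fin n) λ v → a v ≡ x × v ≢ x
      sibling {x} x∈X = Most-∃ x∈X (ℕₚ.≤-trans 0<m (ℕₚ.m≤m+n m m)) (Most-≢ x x)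

      record Twin (x p : Fin n) : Set where
        field
          member : a p ≡ x
          p≢x : p ≢ x
          closest : ∀ v → a v ≡ x → v ≢ x → d p x ≤ d v x

      twin : ∀ {x} → x ∈ X → Σ (Fin n) (Twin x)
      twin {x} x∈X =
        let v , av≡x , v≢x = sibling x∈X
            p , (ap≡x , p≢x) , least-p = least {R = λ p q → d p x ≤ d q x} {P = λ p → a p ≡ x × p ≢ x}
              (λ _ _ → ≤-total _ _) ≤-trans (λ p → (a p ≟ x) ×-dec ¬? (p ≟ x)) v (av≡x , v≢x)
        in p , record { member = ap≡x ; p≢x = p≢x ; closest = λ v av≡x v≢x → least-p v (av≡x , v≢x) }

      -- A center c that beats the twin p at v is within 3 d(v, x) of v, since d(v, p) ≤ 2 d(v, x).
      twin-unbeaten : ∀ {x p L Q} (E : Exchange L Q) → (x , p) List.∈ L → Twin x p → x ∈ X → Resilient x →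
        (c : Exchange.Capture E x) → ¬ Exchange.Kept E (captor c)
      twin-unbeaten {x} {p} E xp∈L twin-p x∈X res c (y∈X , y∉) =
        -- A captor outside the cluster leaves at most `m - 1` exceptions. The one saved pays for
        -- `v ≢ x`, and `isolated` takes the other `m`.
        let b , b<m , most = captures-strictly c ac≢x (assign-self (captor∈Y c))
            v , av≡x , (Av≡c , v≢x) , iso = Most-∃ x∈X (bound b<m) (Most-× (Most-× most (Most-≢ x x)) (isolated x∈X res))
            prefers _ c⊑p near = Cover.assign-prefers cover Av≡c
              (λ e → c≢p (trans e (φ-removed xp∈L av≡x))) (new (All.lookup fallback-new xp∈L)) c≢p
        in iso (captor c) y∈X c≢x (proj₁ near) (≤-trans (⊑⇒≤ c⊑p)
             (≤-trans (triangle-≤ x ≤-refl (within-sym (closest v av≡x v≢x))) (double≤triple (nonneg v x))))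
        where
        open Exchange E
        open Twin twin-p
        c≢x : captor c ≢ x
        c≢x refl = y∉ (∈-map⁺ proj₁ xp∈L)
        ac≢x : a (captor c) ≢ x
        ac≢x e = c≢x (trans (sym (a-fix y∈X)) e)
        c≢p : captor c ≢ p
        c≢p e = center≢ member p≢x (subst (_∈ X) e y∈X)
        bound : ∀ {b} → b ℕ.< m → b ℕ.+ 1 ℕ.+ m ℕ.≤ m ℕ.+ m
        bound {b} b<m = ℕₚ.+-monoˡ-≤ m (subst (ℕ._≤ m) (ℕₚ.+-comm 1 b) b<m)

      -- When the twin replaces `x`, it must be the captor, and a captor takes at most `m` points of
      -- any other cluster.
      twin-steals-little : ∀ {x p l} → x ∈ X → Resilient x → Twin x p → l ≢ x → Most m l (λ v → ¬ Prefers v p l)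
      twin-steals-little {x} {p} {l} x∈X res twin-p l≢x = by-captor (new-or-kept c)
        where
        open Twin twin-p
        E : Exchange ((x , p) ∷ []) (p ∷ [])
        E = record
          { centers-unique = [] ∷ []
          ; centers∈X = x∈X ∷ []
          ; new-unique = [] ∷ []
          ; new-fresh = ⊥-elim ∘ center≢ member p≢x ∷ []
          ; lengths = refl
          ; fallback-new = here refl ∷ []
          ; fallback-covers = (λ v av≡x → ≤-trans (same-cluster av≡x member) (double≤triple 0≤r)) ∷ []
          }
        open Exchange E
        c = capture res

        won : ∀ {v} → a v ≡ l → Prefers v p l → assign v ≡ p
        won {v} refl (prefers _ p⊑l near) = assign-top (new (here refl)) near p⊑
          where
          p⊑ : ∀ y → y ∈ Y → v ⊢ p ⊑ y
          p⊑ y y∈Y with ∈-exchange⁻ {x ∷ []} (p ∷ []) y∈Y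
          ... | inj₁ (here refl) = inj₂ (refl , ℕₚ.≤-refl)
          ... | inj₂ (y∈X , _) = ⊑-trans p⊑l (center-⊑ v y∈X)

        by-captor : captor c List.∈ p ∷ [] ⊎ Kept (captor c) → Most m l (λ v → ¬ Prefers v p l)
        by-captor (inj₁ (here eq)) =
          Most-map (λ v av≡l A≢ pref → A≢ (trans (won av≡l pref) (sym eq))) (nothing-else c l≢x)
        by-captor (inj₂ kept) = contradiction kept (twin-unbeaten E (here refl) twin-p x∈X res c)

      -- The runner-up is determined by the order of the old centers, whatever point replaces `x`.
      first-unique : ∀ {x p p′ t t′} → x ∈ X → Loses x p t → Loses x p′ t′ → t ≡ t′
      first-unique x∈X lo lo′ =
        let _ , _ , t⊑ , t′⊑ = meet x∈X (Loses.first lo) (Loses.first lo′)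
        in ⊑-antisym (t⊑ _ (Loses.t∈X lo′) (Loses.t≢x lo′)) (t′⊑ _ (Loses.t∈X lo) (Loses.t≢x lo))

      module _ {j w : Fin n} (j∈X : j ∈ X) (w∈X : w ∈ X) (w≢j : w ≢ j)
               (resⱼ : Resilient j) (res-w : Resilient w) (covⱼ : Covered j) where

        module _ {p₀ l : Fin n} (p₀∉X : p₀ ∉ X) (w≢l : w ≢ l) (lo : Loses j p₀ l) where
          -- A noncenter replacing `j` is within `r` of most of the cluster of `j` if it wins, and
          -- of most of that of the runner-up `l` if it loses. Neither center is `w`, so `w` can be
          -- replaced in its turn.
          reach : ∀ {v} → v ∉ X → Σ (Fin n) λ c → c ∈ X × c ≢ w × d v c ≤ double r
          reach {v} v∉X with Dichotomy.dichotomy j∈X w∈X w≢j covⱼ resⱼ v∉X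
          ... | inj₁ (_ , near , _) = j , j∈X , w≢j ∘ sym , reaches j∈X near
          ... | inj₂ (t , lo′) with first-unique j∈X lo′ lo
          ...   | refl = t , Loses.t∈X lo′ , w≢l ∘ sym , reaches (Loses.t∈X lo′) (Most-map (λ _ _ → prefers-≤) (Loses.steals lo′))

          cov-w : Covered w
          cov-w v av≡w with v ≟ w
          ... | no v≢w = let c , c∈X , c≢w , le = reach (center≢ av≡w v≢w) in c , c∈X , c≢w , ≤-trans le (double≤triple 0≤r)
          ... | yes refl =
            let v′ , av′≡w , v′≢w = sibling w∈X
                c , c∈X , c≢w , le = reach (center≢ av′≡w v′≢w)
            in c , c∈X , c≢w , via-sibling av′≡w le

          -- Replace `j` and `w` by `p` and `p₀`. The runners-up `l` and `t` remain and keep `p₀`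
          -- from capturing either cluster, while `p` keeps out every old center, so `p` would
          -- capture both.
          no-third : ∀ {t p} → Loses w p₀ t → Twin j p → Wins w p → ⊥
          no-third {t} {p} lo-w twin-p (wins , near , _) = by-captors (new-or-kept cⱼ) (new-or-kept c-w)
            where
            open Twin twin-p
            module J = Loses lo
            module W = Loses lo-w

            -- Otherwise `p₀` would steal most of the resilient cluster of `j` and also of that of
            -- `l`.
            t≢j : t ≢ j
            t≢j refl = W.target-not-resilient resⱼ J.t∈X J.t≢x (w≢l ∘ sym) J.steals

            p₀≢p : p₀ ≢ p
            p₀≢p refl = clash w∈X (wins t W.t∈X W.t≢x) W.not-preferred λ v s ¬s → ¬s s

            E : Exchange ((j , p) ∷ (w , p) ∷ []) (p ∷ p₀ ∷ [])
            E = record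
              { centers-unique = ((w≢j ∘ sym) ∷ []) ∷ [] ∷ []
              ; centers∈X = j∈X ∷ w∈X ∷ []
              ; new-unique = ((p₀≢p ∘ sym) ∷ []) ∷ [] ∷ []
              ; new-fresh = ⊥-elim ∘ center≢ member p≢x ∷ ⊥-elim ∘ p₀∉X ∷ []
              ; lengths = refl
              ; fallback-new = here refl ∷ here refl ∷ []
              ; fallback-covers = (λ v av≡j → ≤-trans (same-cluster av≡j member) (double≤triple 0≤r)) ∷ reaches-cluster w∈X near ∷ []
              }
            open Exchange E
            cⱼ = capture resⱼ
            c-w = capture res-w

            p₀≢∈X : ∀ {y} → y ∈ X → p₀ ≢ y
            p₀≢∈X y∈X refl = p₀∉X y∈X

            remains : ∀ {y} → y ≢ j → y ≢ w → y List.∉ j ∷ w ∷ []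
            remains y≢j y≢w (here e) = y≢j e
            remains y≢j y≢w (there (here e)) = y≢w e

            by-captors : captor cⱼ List.∈ p ∷ p₀ ∷ [] ⊎ Kept (captor cⱼ) → captor c-w List.∈ p ∷ p₀ ∷ [] ⊎ Kept (captor c-w) → ⊥
            by-captors (inj₂ kept) _ = twin-unbeaten E (here refl) twin-p j∈X resⱼ cⱼ kept
            by-captors (inj₁ (there (here eq))) _ = clash j∈X
              (beats (here refl) cⱼ eq p₀≢p (Exchange.kept E J.t∈X (remains J.t≢x (w≢l ∘ sym))) (p₀≢∈X J.t∈X))
              J.not-preferred λ v s ¬s → ¬s s
            by-captors _ (inj₁ (there (here eq))) = clash w∈X
              (beats (there (here refl)) c-w eq p₀≢p (Exchange.kept E W.t∈X (remains t≢j W.t≢x)) (p₀≢∈X W.t∈X))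
              W.not-preferred λ v s ¬s → ¬s s
            by-captors _ (inj₂ kept@(y∈X , y∉)) = clash w∈X
              (kept-beats (there (here refl)) c-w kept (here refl)) (wins _ y∈X λ e → y∉ (there (here e))) λ v → prefers-asym
            by-captors (inj₁ (here eqⱼ)) (inj₁ (here eq-w)) = captor-injective cⱼ c-w j∈X (w≢j ∘ sym) (trans eqⱼ (sym eq-w))

          -- If `p₀` wins at `w`, it steals little from `l`, contrary to losing at `j`. If it loses
          -- to `t`, the twin of `j` cannot win at `w` by `no-third`, nor lose, since it would have
          -- to steal from the same `t`.
          no-loser : ⊥
          no-loser with Dichotomy.dichotomy w∈X j∈X (w≢j ∘ sym) cov-w res-w p₀∉X
          ... | inj₁ (_ , _ , little) = clash (Loses.t∈X lo) (Loses.steals lo) (little l (w≢l ∘ sym)) λ v s ¬s → ¬s s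
          ... | inj₂ (t , lo-w) with twin j∈X
          ...   | p , twin-p with Dichotomy.dichotomy w∈X j∈X (w≢j ∘ sym) cov-w res-w (center≢ (Twin.member twin-p) (Twin.p≢x twin-p))
          ...     | inj₁ wins = no-third lo-w twin-p wins
          ...     | inj₂ (t′ , lo-w′) with first-unique w∈X lo-w′ lo-w
          ...       | refl = clash (Loses.t∈X lo-w) (Loses.steals lo-w′)
            (twin-steals-little j∈X resⱼ twin-p λ { refl → Loses.target-not-resilient lo-w resⱼ (Loses.t∈X lo) (Loses.t≢x lo) (w≢l ∘ sym) (Loses.steals lo) })
            λ v s ¬s → ¬s s

      Rejects Prefers-most : Fin n → Fin n → Fin n → Set
      Rejects x p q = Most m x (λ v → ¬ Prefers v p q)
      Prefers-most x p q = Most m x (λ v → Prefers v p q)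

      -- The case where every noncenter wins the cluster of `j`.

      module AlwaysWins {i j z : Fin n} (i∈X : i ∈ X) (j∈X : j ∈ X) (z∈X : z ∈ X)
        (i≢j : i ≢ j) (i≢z : i ≢ z) (j≢z : j ≢ z)
        (resᵢ : Resilient i) (resⱼ : Resilient j) (res-z : Resilient z)
        (wins : ∀ {p} → p ∉ X → Wins j p) where

        Free : Fin n → Set
        Free p = p ∈ X → p ≡ j

        ∉X⇒free : ∀ {p} → p ∉ X → Free p
        ∉X⇒free p∉X p∈X = contradiction p∈X p∉X

        near-j : ∀ p → Free p → Most m j (λ v → d v p ≤ r)
        near-j p free with p ∈? X
        ... | no p∉X = proj₁ (proj₂ (wins p∉X))
        ... | yes p∈X with free p∈X
        ...   | refl = Most-all λ v av≡j → subst (λ c → d v c ≤ r) av≡j (a-within v)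

        free-close : ∀ {p q} → Free p → Free q → d p q ≤ double r
        free-close {p} {q} fp fq = let v , _ , dvp , dvq = meet j∈X (near-j p fp) (near-j q fq) in
          triangle-≤ v (within-sym dvp) dvq

        -- Free points are all near most of the cluster of `j`, hence within `2r` of each other; a
        -- center is reached through a sibling. One free point thus makes an exchange admissible.
        free-covers : ∀ {p} → Free p → ∀ v → d v p ≤ triple r
        free-covers free v with v ∈? X
        ... | no v∉X = ≤-trans (free-close (∉X⇒free v∉X) free) (double≤triple 0≤r)
        ... | yes v∈X = let v′ , av′≡v , v′≢v = sibling v∈X in
          via-sibling av′≡v (free-close (∉X⇒free (center≢ av′≡v v′≢v)) free)

        -- A kept center capturing the cluster of `x` is preferred there to every new point, so one
        -- undominated new point forces the captor to be new.
        Undominated : Fin n → Fin n → Set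
        Undominated x p = ∀ c → c ∈ X → c ≢ x → c ≢ j → ¬ Prefers-most x c p

        undominated-j : ∀ {p} → Free p → Undominated j p
        undominated-j {p} free c c∈X c≢j _ pref with p ∈? X
        ... | no p∉X = clash j∈X pref (proj₁ (wins p∉X) c c∈X c≢j) λ v → prefers-asym
        ... | yes p∈X with free p∈X
        ...   | refl = let v , av≡j , pr = some j∈X pref in center-unbeaten c∈X (subst (Prefers v c) (sym av≡j) pr)

        module Pair {x p q : Fin n} (x∈X : x ∈ X) (x≢j : x ≢ j) (res-x : Resilient x)
                    (fp : Free p) (fq : Free q) (p≢q : p ≢ q) (und : Undominated x p ⊎ Undominated x q) where
          E : Exchange ((x , p) ∷ (j , p) ∷ []) (p ∷ q ∷ [])
          E = record
            { centers-unique = (x≢j ∷ []) ∷ [] ∷ []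
            ; centers∈X = x∈X ∷ j∈X ∷ []
            ; new-unique = (p≢q ∷ []) ∷ [] ∷ []
            ; new-fresh = (λ p∈X → there (here (fp p∈X))) ∷ (λ q∈X → there (here (fq q∈X))) ∷ []
            ; lengths = refl
            ; fallback-new = here refl ∷ here refl ∷ []
            ; fallback-covers = (λ v _ → free-covers fp v) ∷ (λ v _ → free-covers fp v) ∷ []
            }
          open Exchange E
          c = capture res-x
          cⱼ = capture resⱼ

          -- The captors for `x` and `j` are new and distinct, hence `p` and `q` in some order. As
          -- `p` is the fallback, a capture by `q` means a preference.
          opposite : (Prefers-most x q p × Rejects j q p) ⊎ (Rejects x q p × Prefers-most j q p)
          opposite = by-captors (new-or-kept c) (new-or-kept cⱼ)
            where
            dominated : ∀ {y} → y ∈ X → y List.∉ x ∷ j ∷ [] → Prefers-most x y p → Prefers-most x y q → ⊥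
            dominated {y} y∈X y∉ over-p over-q = [ (λ u → u y y∈X (y∉ ∘ here) (λ e → y∉ (there (here e))) over-p)
                                                  , (λ u → u y y∈X (y∉ ∘ here) (λ e → y∉ (there (here e))) over-q) ]′ und
            by-captors : captor c List.∈ p ∷ q ∷ [] ⊎ Kept (captor c) → captor cⱼ List.∈ p ∷ q ∷ [] ⊎ Kept (captor cⱼ) →
              (Prefers-most x q p × Rejects j q p) ⊎ (Rejects x q p × Prefers-most j q p)
            by-captors (inj₂ kept@(y∈X , y∉)) _ =
              ⊥-elim (dominated y∈X y∉ (kept-beats (here refl) c kept (here refl)) (kept-beats (here refl) c kept (there (here refl))))
            by-captors _ (inj₂ kept@(y∈X , y∉)) =
              let y≢j = λ e → y∉ (there (here e)) in
              ⊥-elim (undominated-j fp _ y∈X y≢j y≢j (kept-beats (there (here refl)) cⱼ kept (here refl)))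
            by-captors (inj₁ (here e)) (inj₁ (here eⱼ)) = contradiction (trans e (sym eⱼ)) (captor-injective c cⱼ x∈X x≢j)
            by-captors (inj₁ (here e)) (inj₁ (there (here eⱼ))) = inj₂
              (unbeaten c e (new (there (here refl))) , beats (there (here refl)) cⱼ eⱼ (p≢q ∘ sym) (new (here refl)) (p≢q ∘ sym))
            by-captors (inj₁ (there (here e))) (inj₁ (here eⱼ)) = inj₁
              (beats (here refl) c e (p≢q ∘ sym) (new (here refl)) (p≢q ∘ sym) , unbeaten cⱼ eⱼ (new (there (here refl))))
            by-captors (inj₁ (there (here e))) (inj₁ (there (here eⱼ))) = contradiction (trans e (sym eⱼ)) (captor-injective c cⱼ x∈X x≢j)

        -- The clusters of i and z both oppose that of j, hence agree.
        agree : ∀ {p q} → Free p → Free q → p ≢ q →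
          Undominated i p ⊎ Undominated i q → Undominated z p ⊎ Undominated z q →
          (Prefers-most i q p × Prefers-most z q p) ⊎ (Rejects i q p × Rejects z q p)
        agree fp fq p≢q uᵢ u-z
          with Pair.opposite i∈X i≢j resᵢ fp fq p≢q uᵢ | Pair.opposite z∈X (j≢z ∘ sym) res-z fp fq p≢q u-z
        ... | inj₁ (s , _) | inj₁ (t , _) = inj₁ (s , t)
        ... | inj₂ (s , _) | inj₂ (t , _) = inj₂ (s , t)
        ... | inj₁ (_ , s) | inj₂ (_ , t) = ⊥-elim (clash j∈X t s λ v s ¬s → ¬s s)
        ... | inj₂ (_ , s) | inj₁ (_ , t) = ⊥-elim (clash j∈X s t λ v s ¬s → ¬s s)

        -- If `p` loses at `x`, the runner-up is `j`, because `p` wins at `j` and so steals little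
        -- from other clusters. Then `j` comes before all other remaining centers.
        rival : ∀ {x p} → x ∈ X → x ≢ j → Resilient x → p ∉ X →
                Undominated x p ⊎ (Undominated x j × Rejects x p j)
        rival {x} {p} x∈X x≢j res p∉X
          with Dichotomy.dichotomy x∈X j∈X (x≢j ∘ sym) (λ v _ → j , j∈X , x≢j ∘ sym , free-covers (λ _ → refl) v) res p∉X
        ... | inj₁ (w , _) = inj₁ λ c c∈X c≢x _ pref → clash x∈X pref (w c c∈X c≢x) λ v → prefers-asym
        ... | inj₂ (t , lo) with t ≟ j
        ...   | no t≢j = ⊥-elim (clash (Loses.t∈X lo) (Loses.steals lo) (proj₂ (proj₂ (wins p∉X)) t t≢j) λ v s ¬s → ¬s s)
        ...   | yes refl = inj₂
          ( (λ c c∈X c≢x c≢j pref → clash x∈X pref (Loses.first lo) λ v pr first → Prefers.≢ pr (⊑-antisym (Prefers.⊑ pr) (first c c∈X c≢x)))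
          , Loses.not-preferred lo)

        ≢j : ∀ {p} → p ∉ X → p ≢ j
        ≢j p∉X refl = p∉X j∈X

        fj : Free j
        fj _ = refl

        triple-exchange : ∀ {q s} → q ∉ X → s ∉ X → q ≢ s → Exchange ((i , j) ∷ (j , j) ∷ (z , j) ∷ []) (j ∷ q ∷ s ∷ [])
        triple-exchange q∉X s∉X q≢s = record
          { centers-unique = (i≢j ∷ i≢z ∷ []) ∷ (j≢z ∷ []) ∷ [] ∷ []
          ; centers∈X = i∈X ∷ j∈X ∷ z∈X ∷ []
          ; new-unique = ((≢j q∉X ∘ sym) ∷ (≢j s∉X ∘ sym) ∷ []) ∷ (q≢s ∷ []) ∷ [] ∷ []
          ; new-fresh = (λ _ → there (here refl)) ∷ ⊥-elim ∘ q∉X ∷ ⊥-elim ∘ s∉X ∷ []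
          ; lengths = refl
          ; fallback-new = here refl ∷ here refl ∷ here refl ∷ []
          ; fallback-covers = (λ v _ → free-covers fj v) ∷ (λ v _ → free-covers fj v) ∷ (λ v _ → free-covers fj v) ∷ []
          }

        module Triple {q s : Fin n} (q∉X : q ∉ X) (s∉X : s ∉ X) (q≢s : q ≢ s)
                      (E : Exchange ((i , j) ∷ (j , j) ∷ (z , j) ∷ []) (j ∷ q ∷ s ∷ [])) where
          private
            L : List (Fin n × Fin n)
            L = (i , j) ∷ (j , j) ∷ (z , j) ∷ []
            Q : List (Fin n)
            Q = j ∷ q ∷ s ∷ []

          fq : Free q
          fq = ∉X⇒free q∉X

          fs : Free s
          fs = ∉X⇒free s∉X

          open Exchange E
          cᵢ = capture resᵢ
          c-z = capture res-z

          undominated : ∀ {x p} → x ∈ X → x ≢ j → Resilient x → p ∉ X → Undominated x j ⊎ Undominated x p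
          undominated x∈X x≢j res p∉X = [ inj₂ , inj₁ ∘ proj₁ ]′ (rival x∈X x≢j res p∉X)

          dominates : ∀ {x y p} → Undominated x p → (x , j) List.∈ L → Kept y → ¬ Prefers-most x y p
          dominates u p kept = u _ (proj₁ kept) (kept≢removed p kept) (kept≢removed (there (here refl)) kept)

          captor∈new : ∀ {x} → x ∈ X → x ≢ j → Resilient x → (x , j) List.∈ L → (c : Capture x) → captor c List.∈ Q
          captor∈new {x} x∈X x≢j res p c = [ (λ c∈ → c∈) , (λ kept → ⊥-elim (dominating kept (undominated x∈X x≢j res q∉X))) ]′ (new-or-kept c)
            where
            dominating : Kept (captor c) → Undominated x j ⊎ Undominated x q → ⊥
            dominating kept (inj₁ u) = dominates u p kept (kept-beats p c kept (here refl))
            dominating kept (inj₂ u) = dominates u p kept (kept-beats p c kept (there (here refl)))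

          Agrees-on : Fin n → Set
          Agrees-on p = (Prefers-most i p j × Prefers-most z p j) ⊎ (Rejects i p j × Rejects z p j)

          agree-j : ∀ {p} → p ∉ X → Agrees-on p
          agree-j p∉X = agree fj (∉X⇒free p∉X) (≢j p∉X ∘ sym) (undominated i∈X i≢j resᵢ p∉X) (undominated z∈X (j≢z ∘ sym) res-z p∉X)

          beats-j : ∀ {x y} → (x , j) List.∈ L → (c : Capture x) → captor c ≡ y → y ∉ X →
                    Prefers-most x y j
          beats-j p c eq y∉X = beats p c eq (≢j y∉X) (new (here refl)) (≢j y∉X)

          captor-j : ∀ {x} → x ∈ X → x ≢ j → Resilient x → (x , j) List.∈ L →
                     Rejects x q j → Rejects x s j → (c : Capture x) → captor c ≡ j
          captor-j {x} x∈X x≢j res p rq rs c = by-member (captor∈new x∈X x≢j res p c)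
            where
            by-member : captor c List.∈ Q → captor c ≡ j
            by-member (here eq) = eq
            by-member (there (here eq)) = ⊥-elim (clash x∈X (beats-j p c eq q∉X) rq λ v s ¬s → ¬s s)
            by-member (there (there (here eq))) = ⊥-elim (clash x∈X (beats-j p c eq s∉X) rs λ v s ¬s → ¬s s)

          both-reject : Rejects i q j → Rejects i s j → Rejects z q j → Rejects z s j → ⊥
          both-reject iq is zq zs = captor-injective cᵢ c-z i∈X i≢z
            (trans (captor-j i∈X i≢j resᵢ (here refl) iq is cᵢ)
                   (sym (captor-j z∈X (j≢z ∘ sym) res-z (there (there (here refl))) zq zs c-z)))

          -- As `i` and `z` agree in comparisons with `j`, both would reject `q` and `s`, and `j`
          -- would capture both clusters.
          rejects-i-once : Rejects i q j → Rejects i s j → ⊥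
          rejects-i-once iq is = contradict (agree-j q∉X) (agree-j s∉X)
            where
            contradict : Agrees-on q → Agrees-on s → ⊥
            contradict (inj₁ (pq , _)) _ = clash i∈X pq iq λ v s ¬s → ¬s s
            contradict (inj₂ _) (inj₁ (ps , _)) = clash i∈X ps is λ v s ¬s → ¬s s
            contradict (inj₂ (_ , zq)) (inj₂ (_ , zs)) = both-reject iq is zq zs

          rejects-z-once : Rejects z q j → Rejects z s j → ⊥
          rejects-z-once zq zs = contradict (agree-j q∉X) (agree-j s∉X)
            where
            contradict : Agrees-on q → Agrees-on s → ⊥
            contradict (inj₁ (_ , pq)) _ = clash z∈X pq zq λ v s ¬s → ¬s s
            contradict (inj₂ _) (inj₁ (_ , ps)) = clash z∈X ps zs λ v s ¬s → ¬s s
            contradict (inj₂ (iq , _)) (inj₂ (is , _)) = both-reject iq is zq zs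

          undominated-pair : ∀ {x} → x ∈ X → x ≢ j → Resilient x → (Rejects x q j → Rejects x s j → ⊥) →
                             Undominated x q ⊎ Undominated x s
          undominated-pair {x} x∈X x≢j res once = choose (rival x∈X x≢j res q∉X) (rival x∈X x≢j res s∉X)
            where
            choose : Undominated x q ⊎ (Undominated x j × Rejects x q j) →
                     Undominated x s ⊎ (Undominated x j × Rejects x s j) → Undominated x q ⊎ Undominated x s
            choose (inj₁ u) _ = inj₁ u
            choose (inj₂ _) (inj₁ u) = inj₂ u
            choose (inj₂ (_ , rq)) (inj₂ (_ , rs)) = ⊥-elim (once rq rs)

          -- A capture by `j` would mean rejecting both `q` and `s`. So `q` and `s` capture one
          -- cluster each, and the two clusters disagree about them, against `agree-qs`.
          absurd : ⊥
          absurd = by-captors (captor∈new i∈X i≢j resᵢ (here refl) cᵢ) (captor∈new z∈X (j≢z ∘ sym) res-z (there (there (here refl))) c-z)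
            where
            agree-qs : (Prefers-most i s q × Prefers-most z s q) ⊎ (Rejects i s q × Rejects z s q)
            agree-qs = agree fq fs q≢s (undominated-pair i∈X i≢j resᵢ rejects-i-once) (undominated-pair z∈X (j≢z ∘ sym) res-z rejects-z-once)

            split : ∀ {x y} → x ∈ X → y ∈ X → Prefers-most x q s → Prefers-most y s q →
                    (Prefers-most x s q × Prefers-most y s q) ⊎ (Rejects x s q × Rejects y s q) → ⊥
            split x∈X y∈X qs sq (inj₁ (sq′ , _)) = clash x∈X qs sq′ λ v → prefers-asym
            split x∈X y∈X qs sq (inj₂ (_ , ¬sq)) = clash y∈X sq ¬sq λ v s ¬s → ¬s s

            swap : ∀ {A B C D : Set} → (A × B) ⊎ (C × D) → (B × A) ⊎ (D × C)
            swap (inj₁ (x , y)) = inj₁ (y , x)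
            swap (inj₂ (x , y)) = inj₂ (y , x)

            new-beats : ∀ {x y y′} → (x , j) List.∈ L → (c : Capture x) → captor c ≡ y → y ∉ X →
                        y′ List.∈ Q → y ≢ y′ → Prefers-most x y y′
            new-beats p c eq y∉X y′∈ y≢y′ = beats p c eq (≢j y∉X) (new y′∈) y≢y′

            at-q = there (here refl)
            at-s = there (there (here refl))
            at-z = there (there (here refl))

            by-captors : captor cᵢ List.∈ Q → captor c-z List.∈ Q → ⊥
            by-captors (here eq) _ = rejects-i-once (unbeaten cᵢ eq (new at-q)) (unbeaten cᵢ eq (new at-s))
            by-captors _ (here eq) = rejects-z-once (unbeaten c-z eq (new at-q)) (unbeaten c-z eq (new at-s))
            by-captors (there (here e)) (there (here e′)) = captor-injective cᵢ c-z i∈X i≢z (trans e (sym e′))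
            by-captors (there (there (here e))) (there (there (here e′))) = captor-injective cᵢ c-z i∈X i≢z (trans e (sym e′))
            by-captors (there (here e)) (there (there (here e′))) = split i∈X z∈X
              (new-beats (here refl) cᵢ e q∉X at-s q≢s) (new-beats at-z c-z e′ s∉X at-q (q≢s ∘ sym)) agree-qs
            by-captors (there (there (here e))) (there (here e′)) = split z∈X i∈X
              (new-beats at-z c-z e′ q∉X at-s q≢s) (new-beats (here refl) cᵢ e s∉X at-q (q≢s ∘ sym)) (swap agree-qs)

      not-covered : ∀ {i j z : Fin n} → i ∈ X → j ∈ X → z ∈ X → i ≢ j → i ≢ z → j ≢ z →
                    Resilient i → Resilient j → Resilient z → ¬ Covered j
      not-covered {i} {j} {z} i∈X j∈X z∈X i≢j i≢z j≢z resᵢ resⱼ res-z covⱼ =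
        let q , aq≡j , q≢j = sibling j∈X
            -- For positive `m` a cluster has at least three points, hence two noncenters.
            s , as≡j , s≢j , s≢q = Most-∃ j∈X (ℕₚ.+-mono-≤ 0<m 0<m) (Most-× (Most-≢ j j) (Most-≢ j q))
            q∉X = center≢ aq≡j q≢j
            s∉X = center≢ as≡j s≢j
        in Triple.absurd q∉X s∉X (s≢q ∘ sym) (triple-exchange q∉X s∉X (s≢q ∘ sym))
        where
        -- One of `i` and `z` differs from the runner-up `l` and serves as `w` in `no-loser`.
        never-loses : ∀ {p l} → p ∉ X → ¬ Loses j p l
        never-loses {l = l} p∉X lo with i ≟ l
        ... | no i≢l = no-loser j∈X i∈X i≢j resⱼ resᵢ covⱼ p∉X i≢l lo
        ... | yes refl = no-loser j∈X z∈X (j≢z ∘ sym) resⱼ res-z covⱼ p∉X (i≢z ∘ sym) lo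

        wins : ∀ {p} → p ∉ X → Wins j p
        wins p∉X with Dichotomy.dichotomy j∈X i∈X i≢j covⱼ resⱼ p∉X
        ... | inj₁ w = w
        ... | inj₂ (_ , lo) = contradiction lo (never-loses p∉X)

        open AlwaysWins i∈X j∈X z∈X i≢j i≢z j≢z resᵢ resⱼ res-z wins

    -- With m = 0 every resilient cluster is captured by one of its own members.
    deserted⇒0<m : ∀ {x L Q} (E : Exchange L Q) → x List.∈ map proj₁ L → All (λ q → a q ≢ x) Q → Resilient x → 0 ℕ.< m
    deserted⇒0<m {x} E x∈L foreign res = let b , b<m , _ = captures-strictly c (away (new-or-kept c)) (assign-self (captor∈Y c)) in
      ℕₚ.≤-trans (s≤s z≤n) b<m
      where
      open Exchange E
      c = capture res
      away : captor c List.∈ _ ⊎ Kept (captor c) → a (captor c) ≢ x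
      away (inj₁ c∈Q) = All.lookup foreign c∈Q
      away (inj₂ (c∈X , c∉)) ac≡x = c∉ (subst (List._∈ _) (trans (sym ac≡x) (a-fix c∈X)) x∈L)

    -- Positivity of `m`, and separation of resilient clusters.

    spans : ∀ {j u v} → a v ≡ j → d v u ≤ r → ∀ w → a w ≡ j → d w u ≤ triple r
    spans av≡j dvu≤r w aw≡j = triangle-≤ _ (same-cluster aw≡j av≡j) dvu≤r

    module _ {i j : Fin n} (i∈X : i ∈ X) (j∈X : j ∈ X) (i≢j : i ≢ j) (resⱼ : Resilient j)
             {u v : Fin n} (au≡i : a u ≡ i) (av≡j : a v ≡ j) (dvu≤r : d v u ≤ r) where

      noncenter⇒0<m : u ∉ X → 0 ℕ.< m
      noncenter⇒0<m u∉X = deserted⇒0<m E (here refl) ((λ au≡j → i≢j (trans (sym au≡i) au≡j)) ∷ []) resⱼ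
        where
        E : Exchange ((j , u) ∷ []) (u ∷ [])
        E = record
          { centers-unique = [] ∷ []
          ; centers∈X = j∈X ∷ []
          ; new-unique = [] ∷ []
          ; new-fresh = ⊥-elim ∘ u∉X ∷ []
          ; lengths = refl
          ; fallback-new = here refl ∷ []
          ; fallback-covers = spans av≡j dvu≤r ∷ []
          }

      -- Here `u` is `i`, which covers the cluster of `j`, so a noncenter `p` outside that cluster
      -- may replace `j`.
      center⇒0<m : u ∈ X → ∀ {p} → p ∉ X → a p ≢ j → 0 ℕ.< m
      center⇒0<m u∈X {p} p∉X ap≢j = deserted⇒0<m E (here refl) ((λ ai≡j → i≢j (trans (sym (a-fix i∈X)) ai≡j)) ∷ ap≢j ∷ []) resⱼ
        where
        u≡i : u ≡ i
        u≡i = trans (sym (a-fix u∈X)) au≡i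
        -- `i` is removed and put back because a fallback has to be a new point.
        E : Exchange ((j , i) ∷ (i , i) ∷ []) (i ∷ p ∷ [])
        E = record
          { centers-unique = ((i≢j ∘ sym) ∷ []) ∷ [] ∷ []
          ; centers∈X = j∈X ∷ i∈X ∷ []
          ; new-unique = ((λ { refl → p∉X i∈X }) ∷ []) ∷ [] ∷ []
          ; new-fresh = (λ _ → there (here refl)) ∷ ⊥-elim ∘ p∉X ∷ []
          ; lengths = refl
          ; fallback-new = here refl ∷ here refl ∷ []
          ; fallback-covers =
              spans av≡j (subst (λ c → d v c ≤ r) u≡i dvu≤r) ∷
              (λ w aw≡i → subst (λ c → d w c ≤ triple r) aw≡i (≤-trans (a-within w) (x≤triple 0≤r))) ∷ []
          }

    separated : ∀ {i j z} → i ∈ X → j ∈ X → z ∈ X → i ≢ j → i ≢ z → j ≢ z →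
      Resilient i → Resilient j → Resilient z →
      ∀ {u v} → a u ≡ i → a v ≡ j → ¬ (d u v ≤ r)
    separated {i} {j} {z} i∈X j∈X z∈X i≢j i≢z j≢z resᵢ resⱼ res-z {u} {v} au≡i av≡j duv≤r =
      let z′ , az′≡z , z′≢z = sibling z∈X in
      Indispensable.absurd i∈X j∈X z∈X i≢j i≢z j≢z resᵢ resⱼ res-z
        (not-covered j∈X i∈X z∈X (i≢j ∘ sym) j≢z i≢z resⱼ resᵢ res-z)
        (not-covered i∈X j∈X z∈X i≢j i≢z j≢z resᵢ resⱼ res-z)
        (not-covered i∈X z∈X j∈X i≢z i≢j (j≢z ∘ sym) resᵢ res-z resⱼ)
        az′≡z z′≢z au≡i (spans av≡j (within-sym duv≤r))
      where
      -- The point attaining the optimal cost has positive distance from every center.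
      uncovered : Σ (Fin n) (_∉ X)
      uncovered = let v , r≤ = proj₂ (proj₁ (proj₂ optimal)) in
        v , λ v∈X → <⇒≱ 0<r (≤-trans (r≤ v v∈X) (≤-reflexive (refl0 v)))

      0<m : 0 ℕ.< m
      0<m with u ∈? X | v ∈? X | uncovered
      ... | no u∉X | _ | _ = noncenter⇒0<m i∈X j∈X i≢j resⱼ au≡i av≡j (within-sym duv≤r) u∉X
      ... | yes _ | no v∉X | _ = noncenter⇒0<m j∈X i∈X (i≢j ∘ sym) resᵢ av≡j au≡i duv≤r v∉X
      ... | yes u∈X | yes v∈X | p , p∉X with a p ≟ j
      ...   | no ap≢j = center⇒0<m i∈X j∈X i≢j resⱼ au≡i av≡j (within-sym duv≤r) u∈X p∉X ap≢j
      ...   | yes ap≡j = center⇒0<m j∈X i∈X (i≢j ∘ sym) resᵢ av≡j au≡i duv≤r v∈X p∉X λ ap≡i → i≢j (trans (sym ap≡i) ap≡j)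

      open NonDegenerate 0<m

-- Choice of a third resilient cluster, and the theorem.

third : ∀ {n} {P : Fin n → Set} (i j : Fin n) {c₁ c₂ c₃ : Fin n} → c₁ ≢ c₂ → c₁ ≢ c₃ → c₂ ≢ c₃ →
        P c₁ → P c₂ → P c₃ → Σ (Fin n) λ z → P z × i ≢ z × j ≢ z
third i j {c₁} {c₂} {c₃} c₁≢c₂ c₁≢c₃ c₂≢c₃ p₁ p₂ p₃ with i ≟ c₁ | j ≟ c₁
... | no i≢ | no j≢ = c₁ , p₁ , i≢ , j≢
... | yes refl | _ with j ≟ c₂
...   | no j≢ = c₂ , p₂ , c₁≢c₂ , j≢
...   | yes refl = c₃ , p₃ , c₁≢c₃ , c₂≢c₃
third i j {c₁} {c₂} {c₃} c₁≢c₂ c₁≢c₃ c₂≢c₃ p₁ p₂ p₃ | no _ | yes refl with i ≟ c₂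
...   | no i≢ = c₂ , p₂ , i≢ , c₁≢c₂
...   | yes refl = c₃ , p₃ , c₂≢c₃ , c₁≢c₃

theorem4 : (F : OrderedField) → let open OrderedField F in let open KCenter F in
    (n k : ℕ) (d : Dist n) → IsMetric d →
    (X : Subset n) (r* : Carrier) → IsOptimalCenters k d X r* →
    (a : Fin n → Fin n) → IsVoronoi d X a →
    (ε : Carrier) → 0# < ε →
    (∀ c → c ∈ X → (1# + 1#) * ε * fromℕ n < fromℕ ∣ cluster a c ∣) →
    Σ (Fin n) (λ c₁ → Σ (Fin n) (λ c₂ → Σ (Fin n) (λ c₃ →
    c₁ ∈ X × c₂ ∈ X × c₃ ∈ X × c₁ ≢ c₂ × c₁ ≢ c₃ × c₂ ≢ c₃ ×
    LocallyPR k d (1# + 1# + 1#) ε (cluster a c₁) ×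
    LocallyPR k d (1# + 1# + 1#) ε (cluster a c₂) ×
    LocallyPR k d (1# + 1# + 1#) ε (cluster a c₃)))) →
    ∀ (ci cj : Fin n) → ci ∈ X → cj ∈ X → ci ≢ cj →
    LocallyPR k d (1# + 1# + 1#) ε (cluster a ci) →
    LocallyPR k d (1# + 1# + 1#) ε (cluster a cj) →
    ∀ (u v : Fin n) → u ∈ cluster a ci → v ∈ cluster a cj →
    r* < d u v
theorem4 F n k d metric X r* optimal a voronoi ε 0<ε sizes
  (c₁ , c₂ , c₃ , c₁∈X , c₂∈X , c₃∈X , c₁≢c₂ , c₁≢c₃ , c₂≢c₃ , res₁ , res₂ , res₃)
  ci cj ci∈X cj∈X ci≢cj resᵢ resⱼ u v u∈ v∈ = [ (λ r*<d → r*<d) , (λ d≤r* → ⊥-elim (too-close d≤r*)) ]′ (<⊎≥ r* (d u v))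
  where
  open OrderedField F
  open KCenter F
  open OrderedFieldProperties F
  open LocalResilience F

  2εn<size : ∀ {c} → c ∈ X → double (ε * fromℕ n) < fromℕ ∣ cluster a c ∣
  2εn<size {c} c∈X = subst (_< fromℕ ∣ cluster a c ∣)
    (trans (IsCommutativeRing.*-assoc isCommutativeRing (1# + 1#) ε (fromℕ n)) (double-* (ε * fromℕ n))) (sizes c c∈X)

  0≤εn : 0# ≤ ε * fromℕ n
  0≤εn = *-nonneg (proj₁ 0<ε) (fromℕ-nonneg n)

  ⌊εn⌋ : Σ ℕ λ m → fromℕ m ≤ ε * fromℕ n × (∀ c → fromℕ c ≤ ε * fromℕ n → c ℕ.≤ m)
  ⌊εn⌋ = floor ∣ cluster a ci ∣ 0≤εn (≤-<-trans (x≤x+y 0≤εn) (2εn<size ci∈X))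

  au≡ci : a u ≡ ci
  au≡ci = ∈-cluster⁻ F u∈

  av≡cj : a v ≡ cj
  av≡cj = ∈-cluster⁻ F v∈

  too-close : ¬ (d u v ≤ r*)
  too-close duv≤r* =
    let z , (z∈X , res-z) , ci≢z , cj≢z = third {P = λ c → c ∈ X × LocallyPR k d (1# + 1# + 1#) ε (cluster a c)} ci cj
          c₁≢c₂ c₁≢c₃ c₂≢c₃ (c₁∈X , res₁) (c₂∈X , res₂) (c₃∈X , res₃)
    in Captors.separated setting ci∈X cj∈X z∈X ci≢cj ci≢z cj≢z resᵢ resⱼ res-z au≡ci av≡cj duv≤r*
    where
    open IsMetric metric using (nonneg; zero-iff)

    -- With radius zero, `u` and `v` would coincide although they lie in different clusters.
    0≢r* : 0# ≢ r*
    0≢r* 0≡r* = ci≢cj (trans (sym au≡ci) (trans (cong a u≡v) av≡cj))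
      where
      u≡v : u ≡ v
      u≡v = zero-iff u v (≤-antisym (subst (d u v ≤_) (sym 0≡r*) duv≤r*) (nonneg u v))

    setting : Setting
    setting = record
      { d = d
      ; metric = metric
      ; X = X
      ; r = r*
      ; optimal = optimal
      ; a = a
      ; voronoi = voronoi
      ; ε = ε
      ; m = proj₁ ⌊εn⌋
      ; floor-ε = proj₂ (proj₂ ⌊εn⌋)
      ; large = λ {c} c∈X → double<fromℕ (proj₁ ⌊εn⌋) ∣ cluster a c ∣ (proj₁ (proj₂ ⌊εn⌋)) (2εn<size c∈X)
      ; 0<r = ≤-trans (nonneg u v) duv≤r* , 0≢r*
      }
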